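{- Let $\Delta\ge1$ be an integer and let $G=(V,E)$ be an $n$-vertex, unweighted, undirected graph whose edges are colored so that every color class has at most $\Delta$ edges. Then there is a $1$-CFT $+2$-spanner $H\subseteq G$ with \[ |E(H)| = O\big(n^{2-1/(\Delta+2)} \cdot \Delta\, (\log n)^{1-1/(\Delta+2)}\big). \]
   Context: An edge-colored graph assigns each edge exactly one color, with no restrictions; a color class is the set of edges of one color. For a color $c$, $G-c$ denotes $G$ with all edges of color $c$ deleted, and $\operatorname{dist}_G(u,v\mid c)$ is the distance from $u$ to $v$ in $G-c$. A subgraph $H\subseteq G$ is a $1$-CFT $+2$-spanner if for every color $c$ and all $u,v\in V$, $\operatorname{dist}_H(u,v\mid c)\le \operatorname{dist}_G(u,v\mid c)+2$. -}

module Defs where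

open import Data.Nat using (ℕ; zero; suc; _<ᵇ_; _≡ᵇ_; _≤_; _+_)
open import Data.Bool using (Bool; true; false; _∧_; if_then_else_)
open import Data.Fin using (Fin; toℕ)
open import Data.List using (List; map; allFin)
open import Data.Nat.ListAction using (sum)
open import Data.Product using (Σ; _×_; ∃-syntax)
open import Relation.Binary.PropositionalEquality using (_≡_)
open import Relation.Nullary using (¬_)

record Graph (n : ℕ) : Set where
  field
    adj   : Fin n → Fin n → Bool
    sym   : ∀ i j → adj i j ≡ adj j i
    irref : ∀ i → adj i i ≡ false
open Graph public

record Coloring (n : ℕ) : Set where
  field
    col    : Fin n → Fin n → ℕ
    colSym : ∀ i j → col i j ≡ col j i
open Coloring public

countPairs : ∀ {n} → (Fin n → Fin n → Bool) → ℕ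
countPairs {n} P =
  sum (map (λ i → sum (map (λ j → if (P i j ∧ (toℕ i <ᵇ toℕ j)) then 1 else 0)
                           (allFin n)))
           (allFin n))

numEdges : ∀ {n} → Graph n → ℕ
numEdges G = countPairs (adj G)

classSize : ∀ {n} → Graph n → Coloring n → ℕ → ℕ
classSize G κ c = countPairs (λ i j → adj G i j ∧ (col κ i j ≡ᵇ c))

ClassesBounded : ∀ {n} → Graph n → Coloring n → ℕ → Set
ClassesBounded G κ Δ = ∀ c → classSize G κ c ≤ Δ

_⊆G_ : ∀ {n} → Graph n → Graph n → Set
H ⊆G G = ∀ i j → adj H i j ≡ true → adj G i j ≡ true

data Walk {n : ℕ} (G : Graph n) (κ : Coloring n) (c : ℕ) : Fin n → Fin n → ℕ → Set where
  nil  : ∀ u → Walk G κ c u u zero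
  cons : ∀ {u w v k} → adj G u w ≡ true → ¬ (col κ u w ≡ c) →
         Walk G κ c w v k → Walk G κ c u v (suc k)

-- H is a 1-CFT +2-spanner of G (w.r.t. colouring κ):
-- for every colour c and all u v, dist_H(u,v|c) ≤ dist_G(u,v|c) + 2,
-- i.e. whenever G - c has a u-v walk of length k, H - c has one of length ≤ k + 2.
CFT+2Spanner : ∀ {n} → Graph n → Coloring n → Graph n → Set
CFT+2Spanner {n} G κ H =
  ∀ (c : ℕ) (u v : Fin n) (k : ℕ) → Walk G κ c u v k →
  ∃[ k' ] (k' ≤ k + 2 × Walk H κ c u v k')

{-# OPTIONS --safe #-}
module Submission where

open import Defs
open import Data.Bool using (Bool; true; false; T; T?; _∧_; _∨_; not; if_then_else_)
import Data.Bool.Properties as Bool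
open import Data.Fin using (Fin; zero; suc; toℕ)
import Data.Fin.Properties as Fin
open import Data.List using (List; []; _∷_; _++_; allFin; cartesianProduct; concatMap; filter; filterᵇ; length; map; tabulate; upTo)
import Data.List.Membership.DecPropositional as DecMembership
open import Data.List.Membership.Propositional using (_∈_; lose)
open import Data.List.Membership.Propositional.Properties using (∈-allFin; ∈-cartesianProduct⁺; ∈-concatMap⁺; ∈-filter⁺; ∈-length; ∈-map⁺; ∈-upTo⁺; ∈-++⁺ˡ; ∈-++⁺ʳ)
open import Data.List.Properties using (length-++; length-filter; length-map; length-tabulate; length-upTo)
open import Data.List.Relation.Unary.All using (All; []; _∷_)
open import Data.List.Relation.Unary.All.Properties using (all-filter; filter⁺)
open import Data.List.Relation.Unary.AllPairs using ([]; _∷_)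
open import Data.List.Relation.Unary.Any using (here; there)
open import Data.List.Relation.Unary.Unique.Propositional using (Unique)
open import Data.List.Relation.Unary.Unique.Propositional.Properties using (allFin⁺)
open import Data.Nat
open import Data.Nat.DivMod using (m%n<n; m/n*n≤m; m≡m%n+[m/n]*n; m≥n⇒m/n>0)
open import Data.Nat.Induction using (<-rec)
open import Data.Nat.ListAction using (sum)
open import Data.Nat.Logarithm using (⌈log₂_⌉; ⌈log₂⌉-mono-≤; ⌈log₂⌈n/2⌉⌉≡⌈log₂n⌉∸1)
open import Data.Nat.Properties
open import Data.Nat.Tactic.RingSolver using (solve-∀)
open import Data.Product using (∃; ∃-syntax; _×_; _,_; proj₁; proj₂)
open import Data.Sum using (_⊎_; inj₁; inj₂)
open import Function using (_∘_; Equivalence)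
open import Relation.Binary using (tri<; tri≈; tri>)
open import Relation.Binary.PropositionalEquality as ≡ using (_≡_; _≢_; refl; cong; cong₂; subst; trans)
open import Relation.Nullary using (¬_; Dec; yes; no; does)
open import Relation.Nullary.Decidable using (_×-dec_; ¬?; dec-false; dec-true; map′)
open import Relation.Nullary.Negation using (contradiction)
open import Relation.Unary using (Decidable)

-- Fix v and a set of sources S.  Let ℓ be about (n log n)^(1/(Δ+2)), let R_Δ = S, and for e < Δ let R_e be a
-- hitting set for the geodesics of length ℓ^(e+1) avoiding one colour.  For r ∈ R_e keep at v the last edge of a
-- fault-free geodesic π from r and, for each colour on the last ℓ^e edges of π, the last edge of one geodesic from r
-- avoiding it.  These edges preserve all distances from S under any colour c: if c misses π, or meets its last ℓ^e
-- edges, an optimal last edge has been kept; otherwise some edge of c lies farther than ℓ^e from v, so fewer edges of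
-- c remain within that distance, and the last ℓ^e edges of a c-avoiding geodesic meet R_(e-1).  Disjointness of the
-- colour classes makes each level cost only |R_e| ℓ^e ≈ n log n / ℓ edges at v.  Taking for S about ℓ vertices that
-- hit the neighbourhoods of all vertices of degree above n log n / ℓ + 2Δ, even after losing a colour, and keeping also
-- all edges at S and at the other vertices, one gets a +2-spanner: detour through S at the last missing edge of a walk.

-- Finite sums

∑ : ∀ {a} {A : Set a} → List A → (A → ℕ) → ℕ
∑ xs f = sum (map f xs)

∑-mono : ∀ {a} {A : Set a} (xs : List A) {f g : A → ℕ} → (∀ x → f x ≤ g x) → ∑ xs f ≤ ∑ xs g
∑-mono []       f≤g = z≤n
∑-mono (x ∷ xs) f≤g = +-mono-≤ (f≤g x) (∑-mono xs f≤g)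

∑-mono-< : ∀ {a} {A : Set a} {xs : List A} {f g : A → ℕ} {x} → (∀ y → f y ≤ g y) →
           x ∈ xs → f x < g x → ∑ xs f < ∑ xs g
∑-mono-< {xs = _ ∷ xs} f≤g (here refl)  f<g = +-mono-<-≤ f<g (∑-mono xs f≤g)
∑-mono-< {xs = y ∷ xs} f≤g (there x∈xs) f<g = +-mono-≤-< (f≤g y) (∑-mono-< f≤g x∈xs f<g)

term≤∑ : ∀ {a} {A : Set a} {xs : List A} (f : A → ℕ) {x} → x ∈ xs → f x ≤ ∑ xs f
term≤∑ f (here refl)  = m≤m+n _ _
term≤∑ f (there x∈xs) = ≤-trans (term≤∑ f x∈xs) (m≤n+m _ _)

∑-+ : ∀ {a} {A : Set a} (xs : List A) (f g : A → ℕ) → ∑ xs (λ x → f x + g x) ≡ ∑ xs f + ∑ xs g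
∑-+ []       f g = refl
∑-+ (x ∷ xs) f g rewrite ∑-+ xs f g = interchange (f x) (g x) (∑ xs f) (∑ xs g)
  where
  interchange : ∀ p q r s → p + q + (r + s) ≡ p + r + (q + s)
  interchange = solve-∀

∑-≤-const : ∀ {a} {A : Set a} (xs : List A) {f : A → ℕ} {k} → (∀ x → f x ≤ k) → ∑ xs f ≤ length xs * k
∑-≤-const []       f≤k = z≤n
∑-≤-const (x ∷ xs) f≤k = +-mono-≤ (f≤k x) (∑-≤-const xs f≤k)

∑-≥-const : ∀ {a} {A : Set a} {xs : List A} {f : A → ℕ} {k} → All (λ x → k ≤ f x) xs → length xs * k ≤ ∑ xs f
∑-≥-const []           = z≤n
∑-≥-const (k≤fx ∷ k≤f) = +-mono-≤ k≤fx (∑-≥-const k≤f)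

∑-comm : ∀ {a b} {A : Set a} {B : Set b} (xs : List A) (ys : List B) (f : A → B → ℕ) →
         ∑ xs (λ x → ∑ ys (f x)) ≡ ∑ ys (λ y → ∑ xs (λ x → f x y))
∑-comm []       ys f = ∑-zero ys
  where
  ∑-zero : ∀ {b} {B : Set b} (ys : List B) → 0 ≡ ∑ ys (λ _ → 0)
  ∑-zero []       = refl
  ∑-zero (_ ∷ ys) = ∑-zero ys
∑-comm (x ∷ xs) ys f = trans (cong (∑ ys (f x) +_) (∑-comm xs ys f)) (≡.sym (∑-+ ys (f x) _))

averaging : ∀ {a} {A : Set a} (f : A → ℕ) x xs → ∃[ y ] ∑ (x ∷ xs) f ≤ length (x ∷ xs) * f y
averaging f x []       = x , ≤-refl
averaging f x (z ∷ zs) with averaging f z zs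
... | y , avg with ≤-total (f x) (f y)
...   | inj₁ fx≤fy = y , +-mono-≤ fx≤fy avg
...   | inj₂ fy≤fx = x , +-monoʳ-≤ (f x) (≤-trans avg (*-monoʳ-≤ (length (z ∷ zs)) fy≤fx))

-- Counting

⟦_⟧ : Bool → ℕ
⟦ b ⟧ = if b then 1 else 0

⟦⟧≤1 : ∀ b → ⟦ b ⟧ ≤ 1
⟦⟧≤1 false = z≤n
⟦⟧≤1 true  = ≤-refl

⟦⟧-mono : ∀ {a b} → (a ≡ true → b ≡ true) → ⟦ a ⟧ ≤ ⟦ b ⟧
⟦⟧-mono {false} _ = z≤n
⟦⟧-mono {true}  h rewrite h refl = ≤-refl

count : ∀ {n} → (Fin n → Bool) → ℕ
count {n} P = ∑ (allFin n) (⟦_⟧ ∘ P)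

length-allFin : ∀ n → length (allFin n) ≡ n
length-allFin n = length-tabulate {n = n} (λ i → i)

count-mono : ∀ {n} {P Q : Fin n → Bool} → (∀ x → P x ≡ true → Q x ≡ true) → count P ≤ count Q
count-mono {n} P⇒Q = ∑-mono (allFin n) (λ x → ⟦⟧-mono (P⇒Q x))

count-singleton : ∀ {n} (y : Fin n) → 1 ≤ count (λ x → does (x Fin.≟ y))
count-singleton {n} y = subst (_≤ count (λ x → does (x Fin.≟ y))) here-1 (term≤∑ (λ x → ⟦ does (x Fin.≟ y) ⟧) (∈-allFin y))
  where
  here-1 : ⟦ does (y Fin.≟ y) ⟧ ≡ 1
  here-1 with y Fin.≟ y
  ... | yes _  = refl
  ... | no y≢y = contradiction refl y≢y

-- Induction on `k`: the values before `f k` differ from it, so they survive its removal from `P`.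
-- Letting `f` be total, with conditions only below `k`, avoids indices in a bounded type.
injection⇒≤count : ∀ {n} k (P : Fin n → Bool) (f : ℕ → Fin n) →
                   (∀ {i} → i < k → P (f i) ≡ true) →
                   (∀ {i j} → i < j → j < k → f i ≢ f j) →
                   k ≤ count P
injection⇒≤count zero    P f f∈P f-inj = z≤n
injection⇒≤count {n} (suc k) P f f∈P f-inj = begin
  suc k                                              ≡⟨ +-comm 1 k ⟩
  k + 1                                              ≤⟨ +-mono-≤ rest (count-singleton (f k)) ⟩
  count P∖ + count (λ x → does (x Fin.≟ f k))        ≡⟨ ∑-+ (allFin n) (⟦_⟧ ∘ P∖) _ ⟨
  ∑ (allFin n) (λ x → ⟦ P∖ x ⟧ + ⟦ does (x Fin.≟ f k) ⟧) ≤⟨ ∑-mono (allFin n) split ⟩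
  count P                                            ∎
  where
  open ≤-Reasoning
  P∖ : Fin n → Bool
  P∖ x = P x ∧ not (does (x Fin.≟ f k))
  rest : k ≤ count P∖
  rest = injection⇒≤count k P∖ f in-P∖ (λ i<j j<k → f-inj i<j (m<n⇒m<1+n j<k))
    where
    in-P∖ : ∀ {i} → i < k → P∖ (f i) ≡ true
    in-P∖ {i} i<k rewrite f∈P (m<n⇒m<1+n i<k) with f i Fin.≟ f k
    ... | yes eq = contradiction eq (f-inj i<k ≤-refl)
    ... | no _   = refl
  split : ∀ x → ⟦ P∖ x ⟧ + ⟦ does (x Fin.≟ f k) ⟧ ≤ ⟦ P x ⟧
  split x with x Fin.≟ f k
  ... | yes refl rewrite f∈P {k} ≤-refl = ≤-refl
  ... | no _ with P x
  ...   | true  = ≤-refl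
  ...   | false = z≤n

-- Greedy hitting sets

-- Bernoulli's inequality `(1 + t/m)^h ≥ 1 + h t/m` with denominators cleared, so that `m` may be
-- zero.
bernoulli : ∀ m t h → m ^ h * (m + h * t) ≤ (m + t) ^ h * m
bernoulli m t zero    = ≤-reflexive (base m)
  where
  base : ∀ m → 1 * (m + 0) ≡ 1 * m
  base = solve-∀
bernoulli m t (suc h) = begin
  m * m ^ h * (m + (t + h * t))        ≤⟨ *-monoʳ-≤ (m * m ^ h) (m≤m+n _ 0) ⟩
  m * m ^ h * (m + (t + h * t) + 0)    ≤⟨ step m t h (m ^ h) ⟩
  (m + t) * (m ^ h * (m + h * t))      ≤⟨ *-monoʳ-≤ (m + t) (bernoulli m t h) ⟩
  (m + t) * ((m + t) ^ h * m)          ≡⟨ *-assoc (m + t) _ _ ⟨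
  (m + t) * (m + t) ^ h * m            ∎
  where
  open ≤-Reasoning
  expand : ∀ m t h p → m * p * (m + (t + h * t) + 0) + t * p * (h * t) ≡ (m + t) * (p * (m + h * t))
  expand = solve-∀
  step : ∀ m t h p → m * p * (m + (t + h * t) + 0) ≤ (m + t) * (p * (m + h * t))
  step m t h p = ≤-trans (m≤m+n _ _) (≤-reflexive (expand m t h p))

-- A greedy round leaves at most the share `m / (m + t)` of the sets. By Bernoulli, `h` rounds at
-- least halve their number once `h * t` exceeds `m`.
halving : ∀ m t h → m < h * t → 2 * m ^ h ≤ (m + t) ^ h
halving zero      t (suc h) _    = z≤n
halving m@(suc _) t h       m<ht = *-cancelʳ-≤ (2 * m ^ h) ((m + t) ^ h) m (begin
  2 * m ^ h * m            ≡⟨ double (m ^ h) m ⟩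
  m ^ h * (m + m)          ≤⟨ *-monoʳ-≤ (m ^ h) (+-monoʳ-≤ m (<⇒≤ m<ht)) ⟩
  m ^ h * (m + h * t)      ≤⟨ bernoulli m t h ⟩
  (m + t) ^ h * m          ∎)
  where
  open ≤-Reasoning
  double : ∀ p m → 2 * p * m ≡ p * (m + m)
  double = solve-∀

*-^ : ∀ a b k → (a * b) ^ k ≡ a ^ k * b ^ k
*-^ a b zero    = refl
*-^ a b (suc k) rewrite *-^ a b k = interchange a b (a ^ k) (b ^ k)
  where
  interchange : ∀ a b p q → a * b * (p * q) ≡ a * p * (b * q)
  interchange = solve-∀

module _ {I : Set} {n : ℕ} (Z : I → Fin n → Bool) where

  private
    unhit : Fin n → List I → List I
    unhit x = filterᵇ (λ z → not (Z z x))

  length-unhit : ∀ x zs → length (unhit x zs) + ∑ zs (λ z → ⟦ Z z x ⟧) ≡ length zs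
  length-unhit x []       = refl
  length-unhit x (z ∷ zs) with Z z x
  ... | true  = trans (+-suc _ _) (cong suc (length-unhit x zs))
  ... | false = cong suc (length-unhit x zs)

  unhit⁺ : ∀ x {z zs} → z ∈ zs → z ∈ unhit x zs ⊎ Z z x ≡ true
  unhit⁺ x {z} z∈zs with Z z x in eq
  ... | true  = inj₂ refl
  ... | false = inj₁ (∈-filter⁺ (λ z → T? (not (Z z x))) z∈zs (subst (λ b → T (not b)) (≡.sym eq) _))

  -- Double counting: each set has at least `t` of the `n` points, so some point lies in at least
  -- the share `t / n` of the sets and leaves at most the share `m / n`.
  greedy-step : ∀ {m t} → n ≡ m + t → 1 ≤ n → ∀ {zs} → All (λ z → t ≤ count (Z z)) zs →
                ∃[ x ] length (unhit x zs) * n ≤ length zs * m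
  greedy-step {m} {t} n≡m+t 1≤n {zs} large with popular n Z 1≤n zs
    where
    -- `n` and `Z` are quantified anew so that `n` can be matched as a successor; then `allFin n` is
    -- nonempty, as `averaging` requires.
    popular : ∀ n (Z : I → Fin n → Bool) → 1 ≤ n → ∀ zs →
              ∃[ x ] ∑ zs (λ z → count (Z z)) ≤ n * ∑ zs (λ z → ⟦ Z z x ⟧)
    popular n@(suc _) Z _ zs with averaging (λ x → ∑ zs (λ z → ⟦ Z z x ⟧)) zero (tabulate suc)
    ... | x , avg = x , (begin
      ∑ zs (λ z → count (Z z))                       ≡⟨ ∑-comm zs (allFin n) (λ z x → ⟦ Z z x ⟧) ⟩
      ∑ (allFin n) (λ x → ∑ zs (λ z → ⟦ Z z x ⟧))     ≤⟨ avg ⟩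
      length (allFin n) * ∑ zs (λ z → ⟦ Z z x ⟧)      ≡⟨ cong (_* ∑ zs (λ z → ⟦ Z z x ⟧)) (length-allFin n) ⟩
      n * ∑ zs (λ z → ⟦ Z z x ⟧)                      ∎)
      where open ≤-Reasoning
  ... | x , popular = x , +-cancelʳ-≤ (length zs * t) _ _ (begin
    u * n + length zs * t  ≤⟨ +-monoʳ-≤ (u * n) (≤-trans (∑-≥-const large) popular) ⟩
    u * n + n * occ        ≡⟨ factor u n occ ⟩
    n * (u + occ)          ≡⟨ cong₂ _*_ n≡m+t (length-unhit x zs) ⟩
    (m + t) * length zs    ≡⟨ distrib m t (length zs) ⟩
    length zs * m + length zs * t ∎)
    where
    open ≤-Reasoning
    u occ : ℕ
    u   = length (unhit x zs)
    occ = ∑ zs (λ z → ⟦ Z z x ⟧)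
    factor : ∀ u n o → u * n + n * o ≡ n * (u + o)
    factor = solve-∀
    distrib : ∀ m t l → (m + t) * l ≡ l * m + l * t
    distrib = solve-∀

  -- `ys` collects the sets missed by all `q` chosen points; each round multiplies their number by
  -- at most `m / n`.
  greedy : ∀ {m t} → n ≡ m + t → 1 ≤ n → ∀ q {zs} → All (λ z → t ≤ count (Z z)) zs →
           ∃[ R ] ∃[ ys ] length R ≡ q × length ys * n ^ q ≤ length zs * m ^ q ×
             (∀ {z} → z ∈ zs → z ∈ ys ⊎ ∃[ x ] x ∈ R × Z z x ≡ true)
  greedy n≡m+t 1≤n zero    {zs} large = [] , zs , refl , ≤-refl , inj₁
  greedy {m} n≡m+t 1≤n (suc q) {zs} large with greedy-step n≡m+t 1≤n large
  ... | x , few with greedy n≡m+t 1≤n q (filter⁺ (λ z → T? (not (Z z x))) large)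
  ...   | R , ys , lenR , fewer , hit = x ∷ R , ys , cong suc lenR , bound , hit′
    where
    open ≤-Reasoning
    u : ℕ
    u = length (unhit x zs)
    swap : ∀ a b c → a * (b * c) ≡ b * (a * c)
    swap = solve-∀
    bound : length ys * (n * n ^ q) ≤ length zs * (m * m ^ q)
    bound = begin
      length ys * (n * n ^ q)  ≡⟨ swap (length ys) n (n ^ q) ⟩
      n * (length ys * n ^ q)  ≤⟨ *-monoʳ-≤ n fewer ⟩
      n * (u * m ^ q)          ≡⟨ trans (≡.sym (*-assoc n u _)) (cong (_* m ^ q) (*-comm n u)) ⟩
      u * n * m ^ q            ≤⟨ *-monoˡ-≤ (m ^ q) few ⟩
      length zs * m * m ^ q    ≡⟨ *-assoc (length zs) m _ ⟩
      length zs * (m * m ^ q)  ∎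
    hit′ : ∀ {z} → z ∈ zs → z ∈ ys ⊎ ∃[ y ] y ∈ x ∷ R × Z z y ≡ true
    hit′ z∈zs with unhit⁺ x z∈zs
    ... | inj₂ Zzx = inj₂ (x , here refl , Zzx)
    ... | inj₁ z∈u with hit z∈u
    ...   | inj₁ z∈ys          = inj₁ z∈ys
    ...   | inj₂ (y , y∈R , Zzy) = inj₂ (y , there y∈R , Zzy)

  -- Each `n / t` rounds halve the number of missed sets, so `n / t * K` rounds leave less than one
  -- out of fewer than `2 ^ K`. Sets below size `t` are filtered out first, so `zs` may contain
  -- them.
  hitting-set : ∀ K t zs → 1 ≤ t → t ≤ n → length zs < 2 ^ K →
                ∃[ R ] length R * t ≤ n * K ×
                  (∀ {z} → z ∈ zs → t ≤ count (Z z) → ∃[ x ] x ∈ R × Z z x ≡ true)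
  hitting-set K t@(suc _) zs 1≤t t≤n few
    with greedy (≡.sym (m∸n+n≡m t≤n)) (≤-trans 1≤t t≤n) (n / t * K) (all-filter (λ z → t ≤? count (Z z)) zs)
  ... | R , ys , lenR , fewer , hit = R , bound , λ z∈zs t≤ → hit′ (hit (∈-filter⁺ (λ z → t ≤? count (Z z)) z∈zs t≤))
    where
    open ≤-Reasoning
    m h : ℕ
    m = n ∸ t
    h = n / t
    bound : length R * t ≤ n * K
    bound = begin
      length R * t ≡⟨ cong (_* t) lenR ⟩
      h * K * t    ≡⟨ swap h K t ⟩
      h * t * K    ≤⟨ *-monoˡ-≤ K (m/n*n≤m n t) ⟩
      n * K        ∎
      where
      swap : ∀ h K t → h * K * t ≡ h * t * K
      swap = solve-∀
    m<ht : m < h * t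
    m<ht = +-cancelʳ-< t m (h * t) (begin-strict
      m + t          ≡⟨ m∸n+n≡m t≤n ⟩
      n              ≡⟨ m≡m%n+[m/n]*n n t ⟩
      n % t + h * t  <⟨ +-monoˡ-< (h * t) (m%n<n n t) ⟩
      t + h * t      ≡⟨ +-comm t _ ⟩
      h * t + t      ∎)
    growth : 2 ^ K * m ^ (h * K) ≤ n ^ (h * K)
    growth = begin
      2 ^ K * m ^ (h * K)  ≡⟨ cong (2 ^ K *_) (^-*-assoc m h K) ⟨
      2 ^ K * (m ^ h) ^ K  ≡⟨ *-^ 2 (m ^ h) K ⟨
      (2 * m ^ h) ^ K      ≤⟨ ^-monoˡ-≤ K (halving m t h m<ht) ⟩
      ((m + t) ^ h) ^ K    ≡⟨ cong (λ k → (k ^ h) ^ K) (m∸n+n≡m t≤n) ⟩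
      (n ^ h) ^ K          ≡⟨ ^-*-assoc n h K ⟩
      n ^ (h * K)          ∎
    zs′ : List I
    zs′ = filter (λ z → t ≤? count (Z z)) zs
    few′ : length zs′ < 2 ^ K
    few′ = ≤-<-trans (length-filter (λ z → t ≤? count (Z z)) zs) few
    hit′ : ∀ {z} → z ∈ ys ⊎ ∃[ x ] x ∈ R × Z z x ≡ true → ∃[ x ] x ∈ R × Z z x ≡ true
    hit′ (inj₂ h)    = h
    -- A surviving set makes `length ys` positive, so the greedy bound would give
    -- `n ^ q ≤ length zs′ * m ^ q`, against `growth` and `few′`.
    hit′ (inj₁ z∈ys) = contradiction n^q≤ (absurd (m ^ (h * K)) growth)
      where
      n^q≤ : n ^ (h * K) ≤ length zs′ * m ^ (h * K)
      n^q≤ = begin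
        n ^ (h * K)             ≤⟨ m≤n*m _ (length ys) {{>-nonZero (∈-length z∈ys)}} ⟩
        length ys * n ^ (h * K) ≤⟨ fewer ⟩
        length zs′ * m ^ (h * K) ∎
      n^q>0 : 0 < n ^ (h * K)
      n^q>0 = m^n>0 n {{>-nonZero (≤-trans 1≤t t≤n)}} (h * K)
      absurd : ∀ p → 2 ^ K * p ≤ n ^ (h * K) → ¬ n ^ (h * K) ≤ length zs′ * p
      -- The power of `m` vanishes when `t` equals `n` and `K` is positive; multiplying `few′`
      -- strictly is then impossible, but `n ^ q` is still positive.
      absurd zero      _    ≤0 = n≮0 (<-≤-trans n^q>0 (≤-trans ≤0 (≤-reflexive (*-zeroʳ (length zs′)))))
      absurd p@(suc _) 2^Kp n^q = <-irrefl refl (≤-<-trans n^q (<-≤-trans (*-monoˡ-< p few′) 2^Kp))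

-- Walks and geodesics

least : ∀ {P : ℕ → Set} → Decidable P → ∀ {k} → P k → ∃[ m ] P m × (∀ {j} → P j → m ≤ j)
least     P? {zero}  p = zero , p , λ _ → z≤n
least {P} P? {suc k} p with P? zero
... | yes p₀ = zero , p₀ , λ _ → z≤n
... | no ¬p₀ with least (P? ∘ suc) p
...   | m , pm , min = suc m , pm , min′
  where
  min′ : ∀ {j} → P j → suc m ≤ j
  min′ {zero}  p₀ = contradiction p₀ ¬p₀
  min′ {suc j} pj = s≤s (min pj)

module _ {n : ℕ} (G : Graph n) (κ : Coloring n) where

  Step : ℕ → Fin n → Fin n → Set
  Step c u v = adj G u v ≡ true × ¬ col κ u v ≡ c

  Geodesic : ℕ → Fin n → Fin n → ℕ → Set
  Geodesic c u v k = Walk G κ c u v k × (∀ {j} → Walk G κ c u v j → k ≤ j)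

module _ {n : ℕ} {G : Graph n} {κ : Coloring n} {c : ℕ} where

  step-sym : ∀ {u v} → Step G κ c u v → Step G κ c v u
  step-sym {u} {v} (e , ≢c) = trans (Graph.sym G v u) e , λ eq → ≢c (trans (colSym κ u v) eq)

  _++ʷ_ : ∀ {u w v j k} → Walk G κ c u w j → Walk G κ c w v k → Walk G κ c u v (j + k)
  nil _       ++ʷ q = q
  cons e ≢c p ++ʷ q = cons e ≢c (p ++ʷ q)

  snoc : ∀ {u w v k} → Walk G κ c u w k → Step G κ c w v → Walk G κ c u v (suc k)
  snoc (nil _)       (e , ≢c) = cons e ≢c (nil _)
  snoc (cons e ≢c p) s        = cons e ≢c (snoc p s)

  reverse : ∀ {u v k} → Walk G κ c u v k → Walk G κ c v u k
  reverse (nil u)       = nil u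
  reverse (cons e ≢c p) = snoc (reverse p) (step-sym (e , ≢c))

  split : ∀ i {u v j} → Walk G κ c u v (i + j) → ∃[ x ] Walk G κ c u x i × Walk G κ c x v j
  split zero    p             = _ , nil _ , p
  split (suc i) (cons e ≢c p) with split i p
  ... | x , q , r = x , cons e ≢c q , r

  unsnoc : ∀ {u v k} → Walk G κ c u v (suc k) → ∃[ w ] Walk G κ c u w k × Step G κ c w v
  unsnoc (cons e ≢c (nil _))          = _ , nil _ , e , ≢c
  unsnoc (cons e ≢c p@(cons _ _ _)) with unsnoc p
  ... | w , q , s = w , cons e ≢c q , s

  nil-≡ : ∀ {u v} → Walk G κ c u v 0 → u ≡ v
  nil-≡ (nil _) = refl

  splitAt : ∀ {u v k i} → Walk G κ c u v k → i ≤ k → ∃[ x ] Walk G κ c u x i × Walk G κ c x v (k ∸ i)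
  splitAt {i = i} p i≤k = split i (subst (Walk G κ c _ _) (≡.sym (m+[n∸m]≡n i≤k)) p)

  abstract

    walk? : ∀ u v → Decidable (Walk G κ c u v)
    walk? u v zero with u Fin.≟ v
    ... | yes refl = yes (nil u)
    ... | no u≢v   = no λ { (nil _) → u≢v refl }
    walk? u v (suc k) = map′ (λ { (w , (e , ≢c) , p) → cons e ≢c p }) (λ { (cons e ≢c p) → _ , (e , ≢c) , p })
      (Fin.any? λ w → ((adj G u w Bool.≟ true) ×-dec ¬? (col κ u w ≟ c)) ×-dec walk? w v k)

    geodesic : ∀ {u v k} → Walk G κ c u v k → ∃[ m ] Geodesic G κ c u v m
    geodesic {u} {v} = least (walk? u v)

  geodesic-unique : ∀ {u v j k} → Geodesic G κ c u v j → Geodesic G κ c u v k → j ≡ k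
  geodesic-unique (p , min) (q , min′) = ≤-antisym (min q) (min′ p)

  geodesic-suffix : ∀ {u x v i j} → Walk G κ c u x i → Walk G κ c x v j →
                    Geodesic G κ c u v (i + j) → Geodesic G κ c x v j
  geodesic-suffix {i = i} {j} p q (_ , min) = q , λ q′ → +-cancelˡ-≤ i j _ (min (p ++ʷ q′))

  geodesic-snoc : ∀ {u x v k} → Geodesic G κ c u v (suc k) → Walk G κ c u x k → Step G κ c x v →
                  Geodesic G κ c u x k
  geodesic-snoc (_ , min) p s = p , λ p′ → s≤s⁻¹ (min (snoc p′ s))

  private
    -- Total in the position, as `injection⇒≤count` wants; beyond the end of the walk the junk value
    -- is `u`.
    vertex : ∀ {u v k} → Walk G κ c u v k → ℕ → Fin n
    vertex {u} {k = k} p i with i ≤? k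
    ... | yes i≤k = proj₁ (splitAt p i≤k)
    ... | no _    = u

    vertex-walk : ∀ {u v k} (p : Walk G κ c u v k) {i} → i ≤ k →
                Walk G κ c u (vertex p i) i × Walk G κ c (vertex p i) v (k ∸ i)
    vertex-walk {k = k} p {i} i≤k with i ≤? k
    ... | yes i≤k′ = proj₂ (splitAt p i≤k′)
    ... | no i≰k   = contradiction i≤k i≰k

    -- If positions `i` and `j` carried the same vertex, cutting out the loop between them would
    -- give a shorter walk.
    vertex-injective : ∀ {u v k} (g : Geodesic G κ c u v k) {i j} → i < j → j ≤ k →
                     vertex (proj₁ g) i ≢ vertex (proj₁ g) j
    vertex-injective {u} {k = k} (p , min) {i} {j} i<j j≤k eq = <-irrefl refl (begin-strict
      k           ≤⟨ min (subst (λ x → Walk G κ c u x i) eq (proj₁ (vertex-walk p (≤-trans (<⇒≤ i<j) j≤k)))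
                          ++ʷ proj₂ (vertex-walk p j≤k)) ⟩
      i + (k ∸ j) <⟨ +-monoˡ-< (k ∸ j) i<j ⟩
      j + (k ∸ j) ≡⟨ m+[n∸m]≡n j≤k ⟩
      k           ∎)
      where open ≤-Reasoning

  -- The `k + 1` vertices are distinct. This bounds the search for a walk in `geodesic?`.
  geodesic-short : ∀ {u v k} → Geodesic G κ c u v k → k < n
  geodesic-short {k = k} g = begin
    suc k                        ≤⟨ injection⇒≤count (suc k) (λ _ → true) (vertex (proj₁ g)) (λ _ → refl)
                                      (λ { i<j (s≤s j≤k) → vertex-injective g i<j j≤k }) ⟩
    count {n} (λ _ → true)       ≤⟨ ∑-≤-const (allFin n) (λ _ → ≤-refl) ⟩
    length (allFin n) * 1        ≡⟨ *-identityʳ _ ⟩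
    length (allFin n)            ≡⟨ length-allFin n ⟩
    n                            ∎
    where open ≤-Reasoning

  abstract

    geodesic? : ∀ u v → Dec (∃ (Geodesic G κ c u v))
    geodesic? u v = map′ (λ { (_ , _ , p) → geodesic p }) (λ { (k , g) → k , geodesic-short g , proj₁ g })
      (anyUpTo? (walk? u v) n)

  -- Depends only on the endpoints, the colour and the length, not on a chosen geodesic, so these
  -- data index the sets to be hit. `i < k` leaves at least one edge after `x`.
  OnGeodesic : ℕ → Fin n → Fin n → Fin n → Set
  OnGeodesic k u v x = ∃[ i ] i < k × Walk G κ c u x i × Walk G κ c x v (k ∸ i)

  onGeodesic? : ∀ k u v → Decidable (OnGeodesic k u v)
  onGeodesic? k u v x = anyUpTo? (λ i → walk? u x i ×-dec walk? x v (k ∸ i)) k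

  geodesic≤count : ∀ {u v k} → Geodesic G κ c u v k → k ≤ count (λ x → does (onGeodesic? k u v x))
  geodesic≤count {u} {v} {k} g@(p , _) = injection⇒≤count k _ (vertex p)
    (λ i<k → dec-true (onGeodesic? k u v _) (_ , i<k , vertex-walk p (<⇒≤ i<k)))
    (λ i<j j<k → vertex-injective g i<j (<⇒≤ j<k))

module _ {n : ℕ} (G : Graph n) (κ : Coloring n) (c : ℕ) where

  abstract

    -- Junk value v when there is no geodesic of positive length.
    parent : Fin n → Fin n → Fin n
    parent r v with geodesic? {G = G} {κ} {c} r v
    ... | yes (suc k , p , _) = proj₁ (unsnoc p)
    ... | yes (zero , _)      = v
    ... | no _                = v

    parent-step : ∀ {r v k} → Geodesic G κ c r v (suc k) →
                  Walk G κ c r (parent r v) k × Step G κ c (parent r v) v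
    parent-step {r} {v} g with geodesic? {G = G} {κ} {c} r v
    ... | no ¬g            = contradiction (_ , g) ¬g
    ... | yes (zero , g′)  with () ← geodesic-unique g g′
    ... | yes (suc k′ , g′) with refl ← geodesic-unique g g′ = proj₂ (unsnoc (proj₁ g′))

-- Booleans and strict comparison of edge counts

∧-intro : ∀ {a b} → a ≡ true → b ≡ true → a ∧ b ≡ true
∧-intro refl refl = refl

∧-elimˡ : ∀ {a b} → a ∧ b ≡ true → a ≡ true
∧-elimˡ {true} _ = refl

∧-elimʳ : ∀ {a b} → a ∧ b ≡ true → b ≡ true
∧-elimʳ {true} eq = eq

does⇒ : ∀ {P : Set} (P? : Dec P) → does P? ≡ true → P
does⇒ (yes p) _ = p

≡ᵇ-true : ∀ {a b} → a ≡ b → (a ≡ᵇ b) ≡ true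
≡ᵇ-true {a} {b} eq = Equivalence.to Bool.T-≡ (≡⇒≡ᵇ a b eq)

<ᵇ-true : ∀ {a b} → a < b → (a <ᵇ b) ≡ true
<ᵇ-true a<b = Equivalence.to Bool.T-≡ (<⇒<ᵇ a<b)

module _ {n : ℕ} {P Q : Fin n → Fin n → Bool} (P⇒Q : ∀ i j → P i j ≡ true → Q i j ≡ true) where

  private
    pair-mono : ∀ i j → ⟦ P i j ∧ (toℕ i <ᵇ toℕ j) ⟧ ≤ ⟦ Q i j ∧ (toℕ i <ᵇ toℕ j) ⟧
    pair-mono i j = ⟦⟧-mono (λ h → ∧-intro (P⇒Q i j (∧-elimˡ h)) (∧-elimʳ {P i j} h))

  countPairs-mono : countPairs P ≤ countPairs Q
  countPairs-mono = ∑-mono (allFin n) (λ i → ∑-mono (allFin n) (pair-mono i))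

  countPairs-mono-<′ : ∀ {i j} → toℕ i < toℕ j → P i j ≡ false → Q i j ≡ true → countPairs P < countPairs Q
  countPairs-mono-<′ {i} {j} i<j ¬P Qij = ∑-mono-< (λ i → ∑-mono (allFin n) (pair-mono i)) (∈-allFin i)
    (∑-mono-< (pair-mono i) (∈-allFin j) strict)
    where
    strict : ⟦ P i j ∧ (toℕ i <ᵇ toℕ j) ⟧ < ⟦ Q i j ∧ (toℕ i <ᵇ toℕ j) ⟧
    strict rewrite ¬P | Qij | <ᵇ-true i<j = ≤-refl

  -- `countPairs` only sees pairs with `i` below `j`; by symmetry the extra pair can be put in that
  -- order.
  countPairs-mono-< : (∀ i j → P i j ≡ P j i) → (∀ i j → Q i j ≡ Q j i) →
                      ∀ {i j} → i ≢ j → P i j ≡ false → Q i j ≡ true → countPairs P < countPairs Q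
  countPairs-mono-< P-sym Q-sym {i} {j} i≢j ¬P Qij with <-cmp (toℕ i) (toℕ j)
  ... | tri< i<j _ _ = countPairs-mono-<′ i<j ¬P Qij
  ... | tri≈ _ i≡j _ = contradiction (Fin.toℕ-injective i≡j) i≢j
  ... | tri> _ _ j<i = countPairs-mono-<′ j<i (trans (P-sym j i) ¬P) (trans (Q-sym j i) Qij)

-- Last edges of fault-avoiding geodesics

-- c₀ is a colour of no edge, so that Walk G κ c₀ is the type of walks in the fault-free graph G.
module LastEdges {n : ℕ} (G : Graph n) (κ : Coloring n) (c₀ : ℕ) (fresh : ∀ i j → ¬ col κ i j ≡ c₀) where

  faultFree : ∀ {c u v k} → Walk G κ c u v k → Walk G κ c₀ u v k
  faultFree (nil u)      = nil u
  faultFree (cons e _ p) = cons e (fresh _ _) (faultFree p)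

  -- Iterated parents trace one fixed fault-free geodesic π from `r`, read backwards from `v`; once
  -- `r` is reached the value stays `r`.
  ancestor : Fin n → Fin n → ℕ → Fin n
  ancestor r v zero    = v
  ancestor r v (suc j) = parent G κ c₀ r (ancestor r v j)

  pathColour : Fin n → Fin n → ℕ → ℕ
  pathColour r v j = col κ (ancestor r v (suc j)) (ancestor r v j)

  ancestor-geodesic : ∀ {r v} j i → Geodesic G κ c₀ r v (j + i) → Geodesic G κ c₀ r (ancestor r v j) i
  ancestor-geodesic zero    i g = g
  ancestor-geodesic (suc j) i g
    with g′ ← ancestor-geodesic j (suc i) (subst (Geodesic G κ c₀ _ _) (≡.sym (+-suc j i)) g)
    with p , s ← parent-step G κ c₀ g′ = geodesic-snoc g′ p s

  ancestor-root : ∀ {r v m} → Geodesic G κ c₀ r v m → ancestor r v m ≡ r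
  ancestor-root {m = m} g = ≡.sym (nil-≡ (proj₁ (ancestor-geodesic m 0
    (subst (Geodesic G κ c₀ _ _) (≡.sym (+-identityʳ m)) g))))

  ancestor-adj : ∀ {r v m j} → Geodesic G κ c₀ r v m → j < m →
                 adj G (ancestor r v (suc j)) (ancestor r v j) ≡ true
  ancestor-adj {m = m} {j} g j<m = proj₁ (proj₂ (parent-step G κ c₀ (ancestor-geodesic j (suc (m ∸ suc j))
    (subst (Geodesic G κ c₀ _ _) (≡.sym (trans (+-suc j (m ∸ suc j)) (m+[n∸m]≡n j<m))) g))))

  -- Serves twice: a colour that misses π leaves its segments intact in `G - c`, and for `c₀` the
  -- avoidance hypothesis is `fresh`.
  ancestor-walk : ∀ {r v m c} → Geodesic G κ c₀ r v m → (∀ {j} → j < m → ¬ pathColour r v j ≡ c) →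
                  ∀ i j → i + j ≤ m → Walk G κ c (ancestor r v (i + j)) (ancestor r v j) i
  ancestor-walk g avoids zero    j _  = nil _
  ancestor-walk g avoids (suc i) j ij<m =
    cons (ancestor-adj g ij<m) (avoids ij<m) (ancestor-walk g avoids i j (<⇒≤ ij<m))

  Within : Fin n → ℕ → Fin n → Set
  Within v D u = ∃[ k ] k < suc D × Walk G κ c₀ u v k

  within? : ∀ v D → Decidable (Within v D)
  within? v D u = anyUpTo? (walk? u v) (suc D)

  -- Edges of colour `c` inside the fault-free ball of radius `D` about `v`. Their number is what
  -- drops from level to level in `lastStep`.
  nearEdge : ℕ → Fin n → ℕ → Fin n → Fin n → Bool
  nearEdge c v D i j = (adj G i j ∧ (col κ i j ≡ᵇ c)) ∧ (does (within? v D i) ∧ does (within? v D j))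

  nearEdge-sym : ∀ c v D i j → nearEdge c v D i j ≡ nearEdge c v D j i
  nearEdge-sym c v D i j = cong₂ _∧_ (cong₂ _∧_ (Graph.sym G i j) (cong (_≡ᵇ c) (colSym κ i j)))
    (Bool.∧-comm (does (within? v D i)) _)

  nearEdge-mono : ∀ c v {D D′} → D ≤ D′ → ∀ i j → nearEdge c v D i j ≡ true → nearEdge c v D′ i j ≡ true
  nearEdge-mono c v {D} {D′} D≤D′ i j h = ∧-intro (∧-elimˡ {inClass} h)
    (∧-intro (weaken i (∧-elimˡ (∧-elimʳ {inClass} h)))
             (weaken j (∧-elimʳ {does (within? v D i)} (∧-elimʳ {inClass} h))))
    where
    inClass : Bool
    inClass = adj G i j ∧ (col κ i j ≡ᵇ c)
    weaken : ∀ u → does (within? v D u) ≡ true → does (within? v D′ u) ≡ true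
    weaken u h with does⇒ (within? v D u) h
    ... | k , k≤D , p = dec-true (within? v D′ u) (k , ≤-trans k≤D (s≤s D≤D′) , p)

  nearEdges≤classSize : ∀ c v D → countPairs (nearEdge c v D) ≤ classSize G κ c
  nearEdges≤classSize c v D = countPairs-mono {P = nearEdge c v D} {Q = λ i j → adj G i j ∧ (col κ i j ≡ᵇ c)}
    (λ i j → ∧-elimˡ)

  -- The edge of π at position `j` has its far end at distance `j + 1 > D` from `v`, but both ends
  -- within `m ≤ D′`: the larger ball gains this edge.
  nearEdges-< : ∀ {c r v m D D′ j} → Geodesic G κ c₀ r v m → pathColour r v j ≡ c →
                D ≤ j → j < m → m ≤ D′ → countPairs (nearEdge c v D) < countPairs (nearEdge c v D′)
  nearEdges-< {c} {r} {v} {m} {D} {D′} {j} g@(_ , min) coloured D≤j j<m m≤D′ =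
    countPairs-mono-< (nearEdge-mono c v (≤-trans (≤-trans D≤j (<⇒≤ j<m)) m≤D′))
      (nearEdge-sym c v D) (nearEdge-sym c v D′) a≢b far near
    where
    a b : Fin n
    a = ancestor r v (suc j)
    b = ancestor r v j
    a~b : adj G a b ≡ true
    a~b = ancestor-adj g j<m
    a≢b : a ≢ b
    a≢b eq with () ← trans (≡.sym (subst (λ x → adj G x b ≡ true) eq a~b)) (irref G b)
    walk-to-v : ∀ i → i ≤ m → Walk G κ c₀ (ancestor r v i) v i
    walk-to-v i i≤m = subst (λ x → Walk G κ c₀ (ancestor r v x) v i) (+-identityʳ i)
      (ancestor-walk g (λ _ → fresh _ _) i 0 (subst (_≤ m) (≡.sym (+-identityʳ i)) i≤m))
    root-to-a : Walk G κ c₀ r a (m ∸ suc j)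
    root-to-a = proj₁ (ancestor-geodesic (suc j) (m ∸ suc j) (subst (Geodesic G κ c₀ r v) (≡.sym (m+[n∸m]≡n j<m)) g))
    -- Going from `r` to `a` along π and then to `v` in at most `D ≤ j` steps would be shorter than
    -- π.
    a-far : ¬ Within v D a
    a-far (i , i≤D , p) = <-irrefl refl (begin-strict
      m                     ≤⟨ min (root-to-a ++ʷ p) ⟩
      (m ∸ suc j) + i       <⟨ +-monoʳ-< (m ∸ suc j) (<-≤-trans i≤D (s≤s D≤j)) ⟩
      (m ∸ suc j) + suc j   ≡⟨ m∸n+n≡m j<m ⟩
      m                     ∎)
      where open ≤-Reasoning
    far : nearEdge c v D a b ≡ false
    far rewrite dec-false (within? v D a) a-far = Bool.∧-zeroʳ _
    near : nearEdge c v D′ a b ≡ true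
    near = ∧-intro (∧-intro a~b (≡ᵇ-true coloured))
      (∧-intro (dec-true (within? v D′ a) (suc j , s≤s (≤-trans j<m m≤D′) , walk-to-v (suc j) j<m))
               (dec-true (within? v D′ b) (j , s≤s (≤-trans (<⇒≤ j<m) m≤D′) , walk-to-v j (<⇒≤ j<m))))

  module _ (ℓ : ℕ) where

    -- The tails of the last edges kept at `v` for the source `r` at level `e`. Positions past the
    -- start of π contribute junk colours, which only enlarge `L`.
    Covers : ℕ → Fin n → Fin n → List (Fin n) → Set
    Covers e r v L = parent G κ c₀ r v ∈ L × (∀ {j} → j < ℓ ^ e → parent G κ (pathColour r v j) r v ∈ L)

    LastStep : ℕ → Fin n → Fin n → ℕ → List (Fin n) → Set
    LastStep c r v k L = ∃[ x ] x ∈ L × Walk G κ c r x k × Step G κ c x v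

    -- Settles the cases in which an optimal last edge was kept outright: `c` misses π, or the edge
    -- of colour `c` found on π is among the last `ℓ ^ e`. The other case is passed to `deep`.
    shallow : ∀ e {r v L c k} → Covers e r v L → Geodesic G κ c r v (suc k) →
              (∀ {m j} → Geodesic G κ c₀ r v m → m ≤ suc k → j < m → pathColour r v j ≡ c → ℓ ^ e ≤ j →
                 LastStep c r v k L) →
              LastStep c r v k L
    shallow e {r} {v} {L} {c} {k} (root∈L , coloured∈L) g@(p , min) deep
      with m , g₀ ← geodesic (faultFree p)
      with m≤k ← proj₂ g₀ (faultFree p)
      with anyUpTo? (λ j → pathColour r v j ≟ c) m
    -- π survives in `G - c`, so its length `m` is the distance `suc k` there and its own last edge
    -- serves.
    ... | no clean = parent G κ c₀ r v , root∈L , walk , ancestor-adj g₀ 0<m , λ eq → clean (0 , 0<m , eq)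
      where
      from-root : ∀ i j → i + j ≡ m → Walk G κ c r (ancestor r v j) i
      from-root i j i+j≡m = subst (λ x → Walk G κ c x (ancestor r v j) i)
        (trans (cong (ancestor r v) i+j≡m) (ancestor-root g₀))
        (ancestor-walk g₀ (λ j<m eq → clean (_ , j<m , eq)) i j (≤-reflexive i+j≡m))
      m≡1+k : m ≡ suc k
      m≡1+k = ≤-antisym m≤k (min (from-root m 0 (+-identityʳ m)))
      0<m : 0 < m
      0<m = subst (0 <_) (≡.sym m≡1+k) z<s
      walk : Walk G κ c r (ancestor r v 1) k
      walk = from-root k 1 (trans (+-comm k 1) (≡.sym m≡1+k))
    ... | yes (j , j<m , coloured) with j <? ℓ ^ e
    ...   | yes j<d = parent G κ c r v ,
                      subst (λ c → parent G κ c r v ∈ L) coloured (coloured∈L j<d) , parent-step G κ c g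
    ...   | no j≮d  = deep g₀ m≤k j<m coloured (≮⇒≥ j≮d)

    module _ {Δ : ℕ} (R : ℕ → List (Fin n))
      (hits : ∀ {e} → e < Δ → ∀ p q {a b} → Geodesic G κ (col κ p q) a b (ℓ ^ suc e) →
              ∃[ r ] r ∈ R e × OnGeodesic {G = G} {κ} {col κ p q} (ℓ ^ suc e) a b r)
      {v : Fin n} {L : List (Fin n)}
      (covers : ∀ {e r} → e < Δ → r ∈ R e → Covers e r v L) where

      -- Induction on `e`, a bound for the edges of colour `c` within a radius `D` that covers the
      -- geodesic. At zero, a far edge of that colour is contradictory. Otherwise such an edge lies
      -- outside the ball of radius `d`, which leaves at most `e` inside, and the call continues
      -- from a vertex of `R e` with `d` as the new radius.
      lastStep : ∀ {e} → e ≤ Δ → ∀ {r} → Covers e r v L → ∀ {c k D} → Geodesic G κ c r v (suc k) →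
                 suc k ≤ D → countPairs (nearEdge c v D) ≤ e → LastStep c r v k L
      lastStep {zero} _ cov g k<D few = shallow 0 cov g λ g₀ m≤k j<m coloured d≤j →
        contradiction (<-≤-trans (nearEdges-< g₀ coloured d≤j j<m (≤-trans m≤k k<D)) few) n≮0
      lastStep {suc e} e<Δ {r} cov {c} {k} {D} g@(p , _) k<D few = shallow (suc e) cov g deep
        where
        d : ℕ
        d = ℓ ^ suc e
        deep : ∀ {m j} → Geodesic G κ c₀ r v m → m ≤ suc k → j < m → pathColour r v j ≡ c → d ≤ j →
               LastStep c r v k L
        deep {m} {j} g₀ m≤k j<m refl d≤j
          with fewer ← s≤s⁻¹ (<-≤-trans (nearEdges-< g₀ refl d≤j j<m (≤-trans m≤k k<D)) few)
          with d≤1+k ← ≤-trans (≤-trans d≤j (<⇒≤ j<m)) m≤k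
          with w , rw , wv ← splitAt p (m∸n≤m (suc k) d)
          with wv ← subst (Walk G κ c w v) (m∸[m∸n]≡n d≤1+k) wv
          with gwv ← geodesic-suffix rw wv (subst (Geodesic G κ c r v) (≡.sym (m∸n+n≡m d≤1+k)) g)
          -- `c` is the colour of an edge of π, and the ends of that edge are the pair that `hits`
          -- asks for.
          with r′ , r′∈R , i , i<d , wr′ , r′v ← hits e<Δ (ancestor r v (suc j)) (ancestor r v j) gwv
          = extend (d ∸ i) refl
          where
          i+ : i + (d ∸ i) ≡ d
          i+ = m+[n∸m]≡n (<⇒≤ i<d)
          -- The remaining length `d ∸ i` is exposed as a successor, the form of the recursive call;
          -- it is positive because `i < d`.
          extend : ∀ h → h ≡ d ∸ i → LastStep c r v k L
          extend zero eq = contradiction (≡.sym eq) (m>n⇒m∸n≢0 i<d)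
          extend (suc k′) eq
            with gr′ ← geodesic-suffix wr′ r′v (subst (Geodesic G κ c w v) (≡.sym i+) gwv)
            with x , x∈L , r′x , xv ← lastStep (<⇒≤ e<Δ) (covers e<Δ r′∈R)
                   (subst (Geodesic G κ c r′ v) (≡.sym eq) gr′)
                   (subst (_≤ d) (≡.sym eq) (m∸n≤m d i)) fewer
            = x , x∈L , subst (Walk G κ c r x) (suc-injective total) (rw ++ʷ (wr′ ++ʷ r′x)) , xv
            where
            open ≡.≡-Reasoning
            total : suc ((suc k ∸ d) + (i + k′)) ≡ suc k
            total = begin
              suc ((suc k ∸ d) + (i + k′))  ≡⟨ +-suc (suc k ∸ d) (i + k′) ⟨
              (suc k ∸ d) + suc (i + k′)    ≡⟨ cong ((suc k ∸ d) +_) (+-suc i k′) ⟨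
              (suc k ∸ d) + (i + suc k′)    ≡⟨ cong (λ h → (suc k ∸ d) + (i + h)) eq ⟩
              (suc k ∸ d) + (i + (d ∸ i))   ≡⟨ cong ((suc k ∸ d) +_) i+ ⟩
              (suc k ∸ d) + d               ≡⟨ m∸n+n≡m d≤1+k ⟩
              suc k                         ∎

-- Spanners from preservers

module _ {n : ℕ} {G H : Graph n} {κ : Coloring n} where

  -- Induction on the distance: the walk to `x` before the kept last edge is again a geodesic from
  -- `s`.
  geodesic-preserved : ∀ {c s} → (∀ {v k} → Geodesic G κ c s v (suc k) →
                         ∃[ x ] adj H x v ≡ true × Walk G κ c s x k × Step G κ c x v) →
                       ∀ {k v} → Geodesic G κ c s v k → Walk H κ c s v k
  geodesic-preserved last {zero}  (nil s , _) = nil s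
  geodesic-preserved last {suc k} g with last g
  ... | x , Hxv , sx , xv@(_ , ≢c) = snoc (geodesic-preserved last (geodesic-snoc g sx xv)) (Hxv , ≢c)

  -- If the last missing edge ends at `y` after `i` steps, with `j` steps left, then `s` is within
  -- `i + 1` of `u`. The preserved walk from `u` to `s`, the edge to `y` and the rest have length at
  -- most `(i + 1) + 1 + j`.
  spanner : (S : List (Fin n)) →
            (∀ c u w → adj G u w ≡ true → adj H u w ≡ true ⊎ ∃[ s ] s ∈ S × Step G κ c w s) →
            (∀ {s w} → s ∈ S → adj G s w ≡ true → adj H s w ≡ true) →
            (∀ {c s k v} → s ∈ S → Geodesic G κ c s v k → Walk H κ c s v k) →
            CFT+2Spanner G κ H
  spanner S missing star preserved c u v k p with suffix p
    where
    -- The tail is examined first, so `y` is the end of the last edge that needs a detour and the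
    -- walk after it lies in `H`.
    suffix : ∀ {u k} → Walk G κ c u v k →
             Walk H κ c u v k ⊎
             ∃[ s ] ∃[ y ] ∃[ i ] ∃[ j ] s ∈ S × Walk G κ c u y i × Step G κ c y s × Walk H κ c y v j × i + j ≡ k
    suffix (nil u) = inj₁ (nil u)
    suffix (cons {u} {w} e ≢c p) with suffix p
    ... | inj₂ (s , y , i , j , s∈S , wy , ys , yv , eq) = inj₂ (s , y , suc i , j , s∈S , cons e ≢c wy , ys , yv , cong suc eq)
    ... | inj₁ q with missing c u w e
    ...   | inj₁ Huw            = inj₁ (cons Huw ≢c q)
    ...   | inj₂ (s , s∈S , ws) = inj₂ (s , w , 1 , _ , s∈S , cons e ≢c (nil w) , ws , q , refl)
  ... | inj₁ q = k , m≤m+n k 2 , q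
  ... | inj₂ (s , y , i , j , s∈S , uy , ys , yv , refl)
    with su ← reverse (snoc uy ys)
    with m , g ← geodesic su
    with s~y , ≢c ← step-sym {G = G} {κ} ys
    = m + suc j , length≤ , (reverse (preserved s∈S g) ++ʷ cons (star s∈S s~y) ≢c yv)
    where
    open ≤-Reasoning
    length≤ : m + suc j ≤ i + j + 2
    length≤ = begin
      m + suc j      ≤⟨ +-monoˡ-≤ (suc j) (proj₂ g su) ⟩
      suc i + suc j  ≡⟨ arith i j ⟩
      i + j + 2      ∎
      where
      arith : ∀ i j → suc i + suc j ≡ i + j + 2
      arith = solve-∀

-- Counting edges

count-singleton≤1 : ∀ {n} (y : Fin n) → count (λ x → does (x Fin.≟ y)) ≤ 1
count-singleton≤1 {n} y = unique≤1 (allFin⁺ n)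
  where
  absent : ∀ {xs} → All (λ x → ¬ y ≡ x) xs → ∑ xs (λ x → ⟦ does (x Fin.≟ y) ⟧) ≤ 0
  absent []                       = z≤n
  absent {x ∷ _} (y≢x ∷ y∉xs) with x Fin.≟ y
  ... | yes x≡y = contradiction (≡.sym x≡y) y≢x
  ... | no _    = absent y∉xs
  unique≤1 : ∀ {xs} → Unique xs → ∑ xs (λ x → ⟦ does (x Fin.≟ y) ⟧) ≤ 1
  unique≤1 []                     = z≤n
  unique≤1 {x ∷ _} (x∉xs ∷ unique) with x Fin.≟ y
  ... | yes refl = s≤s (absent x∉xs)
  ... | no _     = unique≤1 unique

module _ {n : ℕ} where

  open DecMembership (Fin._≟_ {n}) public using (_∈?_)

  count-∈≤length : ∀ L → count (λ x → does (x ∈? L)) ≤ length L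
  count-∈≤length []      = ≤-trans (∑-≤-const (allFin n) (λ _ → z≤n)) (≤-reflexive (*-zeroʳ (length (allFin n))))
  count-∈≤length (y ∷ L) = begin
    count (λ x → does (x ∈? (y ∷ L)))                             ≤⟨ ∑-mono (allFin n) cases ⟩
    ∑ (allFin n) (λ x → ⟦ does (x Fin.≟ y) ⟧ + ⟦ does (x ∈? L) ⟧) ≡⟨ ∑-+ (allFin n) _ _ ⟩
    count (λ x → does (x Fin.≟ y)) + count (λ x → does (x ∈? L))  ≤⟨ +-mono-≤ (count-singleton≤1 y) (count-∈≤length L) ⟩
    suc (length L)                                                ∎
    where
    open ≤-Reasoning
    cases : ∀ x → ⟦ does (x ∈? (y ∷ L)) ⟧ ≤ ⟦ does (x Fin.≟ y) ⟧ + ⟦ does (x ∈? L) ⟧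
    cases x with x Fin.≟ y
    ... | yes _ = ≤-trans (⟦⟧≤1 _) (m≤m+n 1 _)
    ... | no _  with x ∈? L
    ...   | yes _ = ≤-refl
    ...   | no _  = z≤n

  -- Each edge is charged to an endpoint that keeps it. The factor `k` is carried along in place of
  -- a division in the bound per vertex.
  countPairs-∨≤ : ∀ (K : Fin n → Fin n → Bool) k b → (∀ i → k * count (K i) ≤ b) →
                  k * countPairs (λ i j → K i j ∨ K j i) ≤ n * b + n * b
  countPairs-∨≤ K k b count≤b = begin
    k * countPairs (λ i j → K i j ∨ K j i)                    ≤⟨ *-monoʳ-≤ k pairs≤ ⟩
    k * (∑ V (λ i → count (K i)) + ∑ V (λ i → count (K i)))  ≡⟨ *-distribˡ-+ k _ _ ⟩
    k * ∑ V (λ i → count (K i)) + k * ∑ V (λ i → count (K i)) ≤⟨ +-mono-≤ total total ⟩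
    n * b + n * b                                             ∎
    where
    open ≤-Reasoning
    V = allFin n
    drop-< : ∀ p q r → ⟦ (p ∨ q) ∧ r ⟧ ≤ ⟦ p ⟧ + ⟦ q ⟧
    drop-< true  q r = ≤-trans (⟦⟧≤1 r) (m≤m+n 1 _)
    drop-< false true  r = ⟦⟧≤1 r
    drop-< false false r = z≤n
    pairs≤ : countPairs (λ i j → K i j ∨ K j i) ≤ ∑ V (λ i → count (K i)) + ∑ V (λ i → count (K i))
    pairs≤ = begin
      countPairs (λ i j → K i j ∨ K j i)                        ≤⟨ ∑-mono V (λ i → ∑-mono V (λ j → drop-< (K i j) (K j i) _)) ⟩
      ∑ V (λ i → ∑ V (λ j → ⟦ K i j ⟧ + ⟦ K j i ⟧))            ≤⟨ ∑-mono V (λ i → ≤-reflexive (∑-+ V _ _)) ⟩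
      ∑ V (λ i → count (K i) + ∑ V (λ j → ⟦ K j i ⟧))          ≡⟨ ∑-+ V _ _ ⟩
      ∑ V (λ i → count (K i)) + ∑ V (λ i → ∑ V (λ j → ⟦ K j i ⟧)) ≡⟨ cong (∑ V (λ i → count (K i)) +_) (∑-comm V V (λ i j → ⟦ K j i ⟧)) ⟩
      ∑ V (λ i → count (K i)) + ∑ V (λ i → count (K i))        ∎
    total : k * ∑ V (λ i → count (K i)) ≤ n * b
    total = subst (λ m → k * ∑ V (λ i → count (K i)) ≤ m * b) (length-allFin n) (scaled V)
      where
      scaled : ∀ xs → k * ∑ xs (λ i → count (K i)) ≤ length xs * b
      scaled []       = ≤-reflexive (*-zeroʳ k)
      scaled (x ∷ xs) = ≤-trans (≤-reflexive (*-distribˡ-+ k (count (K x)) _)) (+-mono-≤ (count≤b x) (scaled xs))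

  -- Neighbours above `y` and neighbours below `y` each inject into the counted pairs.
  count≤2countPairs : ∀ {P : Fin n → Fin n → Bool} → (∀ i j → P i j ≡ P j i) → (∀ i → P i i ≡ false) →
                      ∀ y → count (P y) ≤ countPairs P + countPairs P
  count≤2countPairs {P} P-sym P-irr y = begin
    count (P y)                                    ≤⟨ ∑-mono V orient ⟩
    ∑ V (λ s → ⟦ upper y s ⟧ + ⟦ upper s y ⟧)      ≡⟨ ∑-+ V _ _ ⟩
    ∑ V (λ s → ⟦ upper y s ⟧) + ∑ V (λ s → ⟦ upper s y ⟧) ≤⟨ +-mono-≤ (term≤∑ (λ i → count (upper i)) (∈-allFin y))
                                                         (∑-mono V (λ s → term≤∑ (λ j → ⟦ upper s j ⟧) (∈-allFin y))) ⟩
    countPairs P + countPairs P                    ∎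
    where
    open ≤-Reasoning
    V = allFin n
    upper : Fin n → Fin n → Bool
    upper i j = P i j ∧ (toℕ i <ᵇ toℕ j)
    orient : ∀ s → ⟦ P y s ⟧ ≤ ⟦ upper y s ⟧ + ⟦ upper s y ⟧
    orient s with <-cmp (toℕ y) (toℕ s)
    ... | tri< y<s _ _ rewrite <ᵇ-true y<s | Bool.∧-identityʳ (P y s) = m≤m+n _ _
    ... | tri> _ _ s<y rewrite <ᵇ-true s<y | Bool.∧-identityʳ (P s y) | P-sym y s = m≤n+m _ _
    ... | tri≈ _ y≡s _ rewrite Fin.toℕ-injective y≡s | P-irr s = z≤n

  numEdges≤n*n : ∀ (G : Graph n) → numEdges G ≤ n * n
  numEdges≤n*n G = subst (λ k → numEdges G ≤ k * k) (length-allFin n) (∑-≤-const (allFin n)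
    (λ i → subst (numEdgesAt i ≤_) (*-identityʳ (length (allFin n))) (∑-≤-const (allFin n) (λ j → ⟦⟧≤1 _))))
    where
    numEdgesAt : Fin n → ℕ
    numEdgesAt i = count (λ j → adj G i j ∧ (toℕ i <ᵇ toℕ j))

length-cartesianProduct : ∀ {A B : Set} (xs : List A) (ys : List B) →
                          length (cartesianProduct xs ys) ≡ length xs * length ys
length-cartesianProduct []       ys = refl
length-cartesianProduct (x ∷ xs) ys = trans (length-++ (map (x ,_) ys))
  (cong₂ _+_ (length-map (x ,_) ys) (length-cartesianProduct xs ys))

length-concatMap : ∀ {A B : Set} (f : A → List B) {k} → (∀ x → length (f x) ≡ k) → ∀ xs →
                   length (concatMap f xs) ≡ length xs * k
length-concatMap f len []       = refl
length-concatMap f len (x ∷ xs) = trans (length-++ (f x)) (cong₂ _+_ (len x) (length-concatMap f len xs))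

freshColour : ∀ {n} (κ : Coloring n) → ∃[ c ] (∀ i j → ¬ col κ i j ≡ c)
freshColour {n} κ = suc (∑ V (λ i → ∑ V (col κ i))) , λ i j eq → <-irrefl eq (s≤s
  (≤-trans (term≤∑ (col κ i) (∈-allFin j)) (term≤∑ (λ i → ∑ V (col κ i)) (∈-allFin i))))
  where
  V = allFin n

-- The construction

-- Faults enter the hitting hypotheses only as colours `col κ p q` of pairs, so finitely many sets
-- have to be hit.
module Construction {n : ℕ} (G : Graph n) (κ : Coloring n) {Δ : ℕ} (bounded : ClassesBounded G κ Δ)
  (c₀ : ℕ) (fresh : ∀ i j → ¬ col κ i j ≡ c₀) (t ℓ : ℕ) (S : List (Fin n)) (R : ℕ → List (Fin n))
  (S-hits : ∀ y p q → t ≤ count (λ s → adj G y s ∧ not (col κ y s ≡ᵇ col κ p q)) →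
            ∃[ s ] s ∈ S × adj G y s ∧ not (col κ y s ≡ᵇ col κ p q) ≡ true)
  (R-hits : ∀ {e} → e < Δ → ∀ p q {a b} → Geodesic G κ (col κ p q) a b (ℓ ^ suc e) →
            ∃[ r ] r ∈ R e × OnGeodesic {G = G} {κ} {col κ p q} (ℓ ^ suc e) a b r) where

  open LastEdges G κ c₀ fresh

  parents : ℕ → Fin n → Fin n → List (Fin n)
  parents e v r = parent G κ c₀ r v ∷ map (λ j → parent G κ (pathColour r v j) r v) (upTo (ℓ ^ e))

  block : List (Fin n) → ℕ → Fin n → List (Fin n)
  block Q e v = concatMap (parents e v) Q

  below : ℕ → Fin n → List (Fin n)
  below zero    v = []
  below (suc e) v = block (R e) e v ++ below e v

  -- `S` itself keeps every edge at a source; its block at level `Δ` and the lower levels meet the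
  -- demands of `lastStep`.
  candidates : Fin n → List (Fin n)
  candidates v = S ++ (block S Δ v ++ below Δ v)

  block-covers : ∀ e {Q r v L} → r ∈ Q → (∀ {x} → x ∈ block Q e v → x ∈ L) → Covers ℓ e r v L
  block-covers e {Q} {r} {v} r∈Q ⊆L =
    ⊆L (∈-concatMap⁺ (parents e v) (lose r∈Q (here refl))) ,
    λ j<d → ⊆L (∈-concatMap⁺ (parents e v) (lose r∈Q (there (∈-map⁺ _ (∈-upTo⁺ j<d)))))

  block⊆below : ∀ {e e′ v x} → e < e′ → x ∈ block (R e) e v → x ∈ below e′ v
  block⊆below {e} {suc e′} {v} (s≤s e≤e′) x∈ with e ≟ e′
  ... | yes refl = ∈-++⁺ˡ x∈
  ... | no e≢e′  = ∈-++⁺ʳ (block (R e′) e′ v) (block⊆below (≤∧≢⇒< e≤e′ e≢e′) x∈)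

  length-block : ∀ Q e v → length (block Q e v) ≡ length Q * suc (ℓ ^ e)
  length-block Q e v = length-concatMap (parents e v)
    (λ r → cong suc (trans (length-map _ (upTo (ℓ ^ e))) (length-upTo (ℓ ^ e)))) Q

  length-below : ∀ {b} → (∀ {e} → e < Δ → ℓ * (length (R e) * suc (ℓ ^ e)) ≤ b) →
                 ∀ e → e ≤ Δ → ∀ v → ℓ * length (below e v) ≤ e * b
  length-below     R≤b zero    _   v = ≤-reflexive (*-zeroʳ ℓ)
  length-below {b} R≤b (suc e) e<Δ v = begin
    ℓ * length (block (R e) e v ++ below e v)                  ≡⟨ cong (ℓ *_) (length-++ (block (R e) e v)) ⟩
    ℓ * (length (block (R e) e v) + length (below e v))        ≡⟨ *-distribˡ-+ ℓ _ _ ⟩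
    ℓ * length (block (R e) e v) + ℓ * length (below e v)      ≡⟨ cong (λ k → ℓ * k + ℓ * length (below e v)) (length-block (R e) e v) ⟩
    ℓ * (length (R e) * suc (ℓ ^ e)) + ℓ * length (below e v)  ≤⟨ +-mono-≤ (R≤b e<Δ) (length-below R≤b e (<⇒≤ e<Δ) v) ⟩
    b + e * b                                                  ∎
    where open ≤-Reasoning

  threshold : ℕ
  threshold = t + (Δ + Δ)

  keeps : Fin n → Fin n → Bool
  keeps v x = adj G v x ∧ ((count (adj G v) <ᵇ threshold) ∨ does (x ∈? candidates v))

  H : Graph n
  H = record
    { adj   = λ i j → keeps i j ∨ keeps j i
    ; sym   = λ i j → Bool.∨-comm (keeps i j) (keeps j i)
    ; irref = λ i → cong₂ _∨_ (keeps-irrefl i) (keeps-irrefl i)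
    }
    where
    keeps-irrefl : ∀ i → keeps i i ≡ false
    keeps-irrefl i rewrite irref G i = refl

  H⊆G : H ⊆G G
  H⊆G i j h with keeps i j in eq
  ... | true  = ∧-elimˡ eq
  ... | false = trans (Graph.sym G i j) (∧-elimˡ h)

  keep-candidate : ∀ {x v} → adj G x v ≡ true → x ∈ candidates v → adj H x v ≡ true
  keep-candidate {x} {v} x~v x∈
    rewrite Graph.sym G v x | x~v | dec-true (x ∈? candidates v) x∈ | Bool.∨-zeroʳ (count (adj G v) <ᵇ threshold)
    = Bool.∨-zeroʳ _

  keep-low : ∀ {u w} → adj G u w ≡ true → count (adj G w) < threshold → adj H u w ≡ true
  keep-low {u} {w} u~w low rewrite Graph.sym G w u | u~w | <ᵇ-true low = Bool.∨-zeroʳ _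

  -- The class of `c` has at most `Δ` edges and so takes at most `2Δ` neighbours of `y`, the
  -- allowance built into `threshold`.
  high-degree : ∀ y c → threshold ≤ count (adj G y) → t ≤ count (λ s → adj G y s ∧ not (col κ y s ≡ᵇ c))
  high-degree y c high = +-cancelʳ-≤ (Δ + Δ) t _ (begin
    threshold                                 ≤⟨ high ⟩
    count (adj G y)                           ≤⟨ ∑-mono (allFin n) (λ s → cases (adj G y s) (col κ y s ≡ᵇ c)) ⟩
    ∑ (allFin n) (λ s → ⟦ adj G y s ∧ not (col κ y s ≡ᵇ c) ⟧ + ⟦ inClass y s ⟧) ≡⟨ ∑-+ (allFin n) _ _ ⟩
    count (λ s → adj G y s ∧ not (col κ y s ≡ᵇ c)) + count (inClass y)
      ≤⟨ +-monoʳ-≤ _ (≤-trans (count≤2countPairs class-sym class-irrefl y) (+-mono-≤ (bounded c) (bounded c))) ⟩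
    count (λ s → adj G y s ∧ not (col κ y s ≡ᵇ c)) + (Δ + Δ) ∎)
    where
    open ≤-Reasoning
    inClass : Fin n → Fin n → Bool
    inClass i j = adj G i j ∧ (col κ i j ≡ᵇ c)
    class-sym : ∀ i j → inClass i j ≡ inClass j i
    class-sym i j = cong₂ _∧_ (Graph.sym G i j) (cong (_≡ᵇ c) (colSym κ i j))
    class-irrefl : ∀ i → inClass i i ≡ false
    class-irrefl i rewrite irref G i = refl
    cases : ∀ p q → ⟦ p ⟧ ≤ ⟦ p ∧ not q ⟧ + ⟦ p ∧ q ⟧
    cases false q     = z≤n
    cases true  true  = ≤-refl
    cases true  false = ≤-refl

  -- A colour of no pair imposes nothing, so the neighbour found for any other colour serves.
  S-neighbour : ∀ y c → threshold ≤ count (adj G y) → ∃[ s ] s ∈ S × Step G κ c y s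
  S-neighbour y c high with Fin.any? (λ p → Fin.any? (λ q → col κ p q ≟ c))
  ... | yes (p , q , refl) with S-hits y p q (high-degree y _ high)
  ...   | s , s∈S , h = s , s∈S , ∧-elimˡ h , λ eq → not-true (≡ᵇ-true eq) (∧-elimʳ {adj G y s} h)
    where
    not-true : ∀ {b} → b ≡ true → ¬ not b ≡ true
    not-true refl ()
  S-neighbour y c high | no unused with S-hits y y y (high-degree y _ high)
  ...   | s , s∈S , h = s , s∈S , ∧-elimˡ h , λ eq → unused (y , s , eq)

  H-spanner : CFT+2Spanner G κ H
  H-spanner = spanner S missing star preserved
    where
    missing : ∀ c u w → adj G u w ≡ true → adj H u w ≡ true ⊎ ∃[ s ] s ∈ S × Step G κ c w s
    missing c u w u~w with count (adj G w) <? threshold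
    ... | yes low  = inj₁ (keep-low u~w low)
    ... | no ¬low = inj₂ (S-neighbour w c (≮⇒≥ ¬low))
    star : ∀ {s w} → s ∈ S → adj G s w ≡ true → adj H s w ≡ true
    star s∈S s~w = keep-candidate s~w (∈-++⁺ˡ s∈S)
    preserved : ∀ {c s k v} → s ∈ S → Geodesic G κ c s v k → Walk H κ c s v k
    preserved {c} {s} s∈S = geodesic-preserved last
      where
      last : ∀ {v k} → Geodesic G κ c s v (suc k) → ∃[ x ] adj H x v ≡ true × Walk G κ c s x k × Step G κ c x v
      -- The recursion starts at level `Δ` with the length of the geodesic as radius; the whole
      -- colour class has at most `Δ` edges.
      last {v} g with lastStep ℓ R R-hits {v} {candidates v}
        (λ {e} e<Δ r∈R → block-covers e r∈R (∈-++⁺ʳ S ∘ ∈-++⁺ʳ (block S Δ v) ∘ block⊆below e<Δ))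
        ≤-refl (block-covers Δ s∈S (∈-++⁺ʳ S ∘ ∈-++⁺ˡ)) g ≤-refl (≤-trans (nearEdges≤classSize c v _) (bounded c))
      ... | x , x∈ , sx , xv = x , keep-candidate (proj₁ xv) x∈ , sx , xv

  keeps-count : ∀ v → count (keeps v) ≤ threshold + length (candidates v)
  keeps-count v with count (adj G v) <? threshold
  ... | yes low = ≤-trans (count-mono {P = keeps v} {Q = adj G v} (λ x → ∧-elimˡ)) (≤-trans (<⇒≤ low) (m≤m+n _ _))
  ... | no ¬low = ≤-trans (count-mono {P = keeps v} {Q = λ x → does (x ∈? candidates v)} candidate) (≤-trans (count-∈≤length (candidates v)) (m≤n+m _ _))
    where
    candidate : ∀ x → keeps v x ≡ true → does (x ∈? candidates v) ≡ true
    candidate x h with count (adj G v) <ᵇ threshold in eq | ∧-elimʳ {adj G v x} h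
    ... | true  | _  = contradiction (<ᵇ⇒< _ _ (Equivalence.from Bool.T-≡ eq)) ¬low
    ... | false | h′ = h′

  length-candidates : ∀ v → length (candidates v) ≡ length S + (length S * suc (ℓ ^ Δ) + length (below Δ v))
  length-candidates v = trans (length-++ S) (cong (length S +_)
    (trans (length-++ (block S Δ v)) (cong (_+ length (below Δ v)) (length-block S Δ v))))

  H-size : ∀ {b} → (∀ {e} → e < Δ → ℓ * (length (R e) * suc (ℓ ^ e)) ≤ b) →
           ∀ {a} → ℓ * (threshold + (length S + length S * suc (ℓ ^ Δ))) + Δ * b ≤ a →
           ℓ * numEdges H ≤ n * a + n * a
  H-size {b} R≤b {a} total≤ = countPairs-∨≤ keeps ℓ a λ v → (begin
    ℓ * count (keeps v)                                         ≤⟨ *-monoʳ-≤ ℓ (keeps-count v) ⟩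
    ℓ * (threshold + length (candidates v))                     ≡⟨ cong (λ k → ℓ * (threshold + k)) (length-candidates v) ⟩
    ℓ * (threshold + (length S + (s + length (below Δ v))))     ≡⟨ regroup ℓ threshold (length S) s _ ⟩
    ℓ * (threshold + (length S + s)) + ℓ * length (below Δ v)   ≤⟨ +-monoʳ-≤ (ℓ * (threshold + (length S + s))) (length-below R≤b Δ ≤-refl v) ⟩
    ℓ * (threshold + (length S + s)) + Δ * b                    ≤⟨ total≤ ⟩
    a                                                           ∎)
    where
    open ≤-Reasoning
    s : ℕ
    s = length S * suc (ℓ ^ Δ)
    regroup : ∀ l t p s b → l * (t + (p + (s + b))) ≡ l * (t + (p + s)) + l * b
    regroup = solve-∀

-- Choice of the parameters

-- Strong induction: `n` is at most twice its upper half, whose logarithm is smaller by one.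
n≤2^⌈log₂n⌉ : ∀ n → n ≤ 2 ^ ⌈log₂ n ⌉
n≤2^⌈log₂n⌉ = <-rec _ step
  where
  open ≤-Reasoning
  halves : ∀ n → n ≤ ⌈ n /2⌉ + ⌈ n /2⌉
  halves n = ≤-trans (≤-reflexive (≡.sym (⌊n/2⌋+⌈n/2⌉≡n n))) (+-monoˡ-≤ ⌈ n /2⌉ (⌊n/2⌋≤⌈n/2⌉ n))
  step : ∀ n → (∀ {m} → m < n → m ≤ 2 ^ ⌈log₂ m ⌉) → n ≤ 2 ^ ⌈log₂ n ⌉
  step zero            _   = z≤n
  step (suc zero)      _   = ≤-refl
  step n@(suc (suc k)) rec = begin
    n                                  ≤⟨ halves n ⟩
    ⌈ n /2⌉ + ⌈ n /2⌉                  ≤⟨ +-mono-≤ (rec half<) (≤-trans (rec half<) (m≤m+n _ 0)) ⟩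
    2 * 2 ^ ⌈log₂ ⌈ n /2⌉ ⌉            ≡⟨ cong (λ l → 2 * 2 ^ l) (⌈log₂⌈n/2⌉⌉≡⌈log₂n⌉∸1 n) ⟩
    2 ^ suc (⌈log₂ n ⌉ ∸ 1)            ≡⟨ cong (2 ^_) (m+[n∸m]≡n (⌈log₂⌉-mono-≤ {2} {n} (s≤s (s≤s z≤n)))) ⟩
    2 ^ ⌈log₂ n ⌉                      ∎
    where
    half< : ⌈ n /2⌉ < n
    half< = ⌈n/2⌉<n k

integerRoot : ∀ k N .{{_ : NonZero k}} → ∃[ ℓ ] ℓ ^ k ≤ N × N < suc ℓ ^ k
integerRoot (suc k) zero    = 0 , z≤n , m^n>0 1 (suc k)
integerRoot k       (suc N) with integerRoot k N
... | ℓ , lower , upper with suc ℓ ^ k ≤? suc N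
...   | yes next = suc ℓ , next , ≤-<-trans upper (^-monoˡ-< k ≤-refl)
...   | no ¬next = ℓ , m≤n⇒m≤1+n lower , ≰⇒> ¬next

root>0 : ∀ k ℓ {N} → 1 ≤ N → N < suc ℓ ^ k → 1 ≤ ℓ
root>0 k zero    1≤N N<1 = contradiction (subst (_ <_) (^-zeroˡ k) N<1) (≤⇒≯ 1≤N)
root>0 k (suc _) _   _   = s≤s z≤n

-- Two endpoints and a pair `p , q` whose colour is removed index the sets to be hit. Naming colours
-- by pairs leaves `n ^ 4` indices, however many colours there are.
quadruples : ∀ n → List (Fin n × Fin n × Fin n × Fin n)
quadruples n = cartesianProduct (allFin n) (cartesianProduct (allFin n) (cartesianProduct (allFin n) (allFin n)))

∈-quadruples : ∀ {n} (a b p q : Fin n) → (a , b , p , q) ∈ quadruples n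
∈-quadruples a b p q =
  ∈-cartesianProduct⁺ (∈-allFin a) (∈-cartesianProduct⁺ (∈-allFin b) (∈-cartesianProduct⁺ (∈-allFin p) (∈-allFin q)))

length-quadruples : ∀ n → length (quadruples n) ≡ n ^ 4
length-quadruples n = fourth-power (allFin n) (length-allFin n)
  where
  fourth-power : ∀ (V : List (Fin n)) → length V ≡ n →
                 length (cartesianProduct V (cartesianProduct V (cartesianProduct V V))) ≡ n ^ 4
  fourth-power V len
    rewrite length-cartesianProduct V (cartesianProduct V (cartesianProduct V V))
          | length-cartesianProduct V (cartesianProduct V V)
          | length-cartesianProduct V V
          | len
          | *-identityʳ n = refl

-- The extra one in the exponent makes the bound strict, as `hitting-set` demands.
few-quadruples : ∀ n → length (quadruples n) < 2 ^ suc (⌈log₂ n ⌉ * 4)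
few-quadruples n = begin-strict
  length (quadruples n)      ≡⟨ length-quadruples n ⟩
  n ^ 4                      ≤⟨ ^-monoˡ-≤ 4 (n≤2^⌈log₂n⌉ n) ⟩
  (2 ^ L) ^ 4                ≡⟨ ^-*-assoc 2 L 4 ⟩
  2 ^ (L * 4)                <⟨ ^-monoʳ-< 2 ≤-refl (n<1+n (L * 4)) ⟩
  2 ^ suc (L * 4)            ∎
  where
  open ≤-Reasoning
  L = ⌈log₂ n ⌉

module _ {n : ℕ} (G : Graph n) (κ : Coloring n) where

  private
    K : ℕ
    K = suc (⌈log₂ n ⌉ * 4)

  neighbour-hitting : ∀ t → 1 ≤ t → t ≤ n → ∃[ S ] length S * t ≤ n * K ×
    (∀ y p q → t ≤ count (λ s → adj G y s ∧ not (col κ y s ≡ᵇ col κ p q)) →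
               ∃[ s ] s ∈ S × adj G y s ∧ not (col κ y s ≡ᵇ col κ p q) ≡ true)
  neighbour-hitting t 1≤t t≤n
    with hitting-set (λ { (y , _ , p , q) s → adj G y s ∧ not (col κ y s ≡ᵇ col κ p q) }) K t (quadruples n) 1≤t t≤n
           (few-quadruples n)
  -- A neighbourhood has a single centre, so `y` fills both endpoint slots.
  ... | S , size , hit = S , size , λ y p q → hit (∈-quadruples y y p q)

  geodesic-hitting : ∀ t → 1 ≤ t → t ≤ n → ∃[ R ] length R * t ≤ n * K ×
    (∀ p q {a b} → Geodesic G κ (col κ p q) a b t → ∃[ r ] r ∈ R × OnGeodesic {G = G} {κ} {col κ p q} t a b r)
  geodesic-hitting t 1≤t t≤n
    with hitting-set (λ { (a , b , p , q) x → does (onGeodesic? {G = G} {κ} {col κ p q} t a b x) }) K t (quadruples n)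
           1≤t t≤n (few-quadruples n)
  ... | R , size , hit = R , size , hits
    where
    hits : ∀ p q {a b} → Geodesic G κ (col κ p q) a b t → ∃[ r ] r ∈ R × OnGeodesic {G = G} {κ} {col κ p q} t a b r
    hits p q {a} {b} g with hit (∈-quadruples a b p q) (geodesic≤count g)
    ... | r , r∈R , h = r , r∈R , does⇒ (onGeodesic? t a b r) h

module _ {n : ℕ} (G : Graph n) (κ : Coloring n) {Δ : ℕ} (bounded : ClassesBounded G κ Δ) (1≤Δ : 1 ≤ Δ)
  (1≤L : 1 ≤ ⌈log₂ n ⌉) where

  private
    L N K : ℕ
    L = ⌈log₂ n ⌉
    N = n * L
    K = suc (L * 4)

    nK≤5N : n * K ≤ 5 * N
    nK≤5N = ≤-trans (*-monoʳ-≤ n (+-monoˡ-≤ (L * 4) 1≤L)) (≤-reflexive (eq n L))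
      where
      eq : ∀ n L → n * (L + L * 4) ≡ 5 * (n * L)
      eq = solve-∀

  -- If `ℓ ≤ L`, all of `G` is small enough, since `L * (n * n) = n * N`. Otherwise `L < ℓ` ensures
  -- that `t` and the needed powers of `ℓ` are at most `n`, so the hitting sets exist.
  sparse-spanner : ∀ ℓ → 1 ≤ ℓ → ℓ ^ (2 + Δ) ≤ N →
                   ∃[ H ] H ⊆G G × CFT+2Spanner G κ H × ℓ * numEdges H ≤ 86 * (Δ * (n * N))
  sparse-spanner ℓ@(suc _) 1≤ℓ root with L <? ℓ
  ... | no L≮ℓ = G , (λ i j e → e) , (λ c u v k p → k , m≤m+n k 2 , p) , (begin
    ℓ * numEdges G          ≤⟨ *-mono-≤ (≮⇒≥ L≮ℓ) (numEdges≤n*n G) ⟩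
    L * (n * n)             ≡⟨ comm L n ⟩
    n * N                   ≤⟨ m≤n*m (n * N) Δ {{>-nonZero 1≤Δ}} ⟩
    Δ * (n * N)             ≤⟨ m≤n*m _ 86 ⟩
    86 * (Δ * (n * N))      ∎)
    where
    open ≤-Reasoning
    comm : ∀ L n → L * (n * n) ≡ n * (n * L)
    comm = solve-∀
  ... | yes L<ℓ = H , H⊆G , H-spanner , (begin
    ℓ * numEdges H                       ≤⟨ H-size {b = 10 * N} R-size {43 * (Δ * N)} total ⟩
    n * (43 * (Δ * N)) + n * (43 * (Δ * N)) ≡⟨ merge n Δ N ⟩
    86 * (Δ * (n * N))                   ∎)
    where
    open ≤-Reasoning
    merge : ∀ n D N → n * (43 * (D * N)) + n * (43 * (D * N)) ≡ 86 * (D * (n * N))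
    merge = solve-∀
    t : ℕ
    t = N / ℓ
    -- One factor `ℓ` of the root bound pays for the factor `L` in `N`.
    powers : ∀ {e} → e ≤ suc Δ → ℓ ^ e ≤ n
    powers {e} e≤ = *-cancelʳ-≤ (ℓ ^ e) n L {{>-nonZero 1≤L}} (begin
      ℓ ^ e * L    ≤⟨ *-monoʳ-≤ (ℓ ^ e) (<⇒≤ L<ℓ) ⟩
      ℓ ^ e * ℓ    ≡⟨ *-comm (ℓ ^ e) ℓ ⟩
      ℓ ^ suc e    ≤⟨ ^-monoʳ-≤ ℓ (s≤s e≤) ⟩
      ℓ ^ (2 + Δ)  ≤⟨ root ⟩
      N            ∎)
    ℓ≤N : ℓ ≤ N
    ℓ≤N = ≤-trans (m≤m*n ℓ (ℓ ^ suc Δ) {{m^n≢0 ℓ (suc Δ)}}) root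
    tℓ≤N : t * ℓ ≤ N
    tℓ≤N = m/n*n≤m N ℓ
    t≤n : t ≤ n
    t≤n = *-cancelʳ-≤ t n L {{>-nonZero 1≤L}} (≤-trans (*-monoʳ-≤ t (<⇒≤ L<ℓ)) tℓ≤N)
    1≤t : 1 ≤ t
    1≤t = m≥n⇒m/n>0 ℓ≤N
    S-data = neighbour-hitting G κ t 1≤t t≤n
    S = proj₁ S-data
    R-data : ∀ e → ∃[ R ] (e < Δ → length R * ℓ ^ suc e ≤ n * K ×
      (∀ p q {a b} → Geodesic G κ (col κ p q) a b (ℓ ^ suc e) →
                     ∃[ r ] r ∈ R × OnGeodesic {G = G} {κ} {col κ p q} (ℓ ^ suc e) a b r))
    R-data e with e <? Δ
    ... | yes e<Δ = let R , h = geodesic-hitting G κ (ℓ ^ suc e) (m^n>0 ℓ (suc e)) (powers (m≤n⇒m≤1+n e<Δ)) in R , λ _ → h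
    -- `R` is total; levels from `Δ` on get the empty list.
    ... | no e≮Δ  = [] , λ e<Δ → contradiction e<Δ e≮Δ
    R : ℕ → List (Fin n)
    R e = proj₁ (R-data e)
    open Construction G κ bounded (proj₁ (freshColour κ)) (proj₂ (freshColour κ)) t ℓ S R
      (proj₂ (proj₂ S-data)) (λ e<Δ → proj₂ (proj₂ (R-data _) e<Δ))
    R-size : ∀ {e} → e < Δ → ℓ * (length (R e) * suc (ℓ ^ e)) ≤ 10 * N
    R-size {e} e<Δ = begin
      ℓ * (r * suc (ℓ ^ e))      ≤⟨ *-monoʳ-≤ ℓ (*-monoʳ-≤ r (+-monoˡ-≤ (ℓ ^ e) (m^n>0 ℓ e))) ⟩
      ℓ * (r * (ℓ ^ e + ℓ ^ e))  ≡⟨ regroup ℓ r (ℓ ^ e) ⟩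
      2 * (r * ℓ ^ suc e)        ≤⟨ *-monoʳ-≤ 2 (≤-trans (proj₁ (proj₂ (R-data e) e<Δ)) nK≤5N) ⟩
      2 * (5 * N)                ≡⟨ *-assoc 2 5 N ⟨
      10 * N                     ∎
      where
      r : ℕ
      r = length (R e)
      regroup : ∀ l r p → l * (r * (p + p)) ≡ 2 * (r * (l * p))
      regroup = solve-∀
    -- As `t ≥ 1`, the remainder of `N` modulo `ℓ` is at most `t * ℓ`. Hence `N ≤ 2 * (t * ℓ)`,
    -- which turns 5 into 10.
    S-size : length S ≤ 10 * ℓ
    S-size = *-cancelʳ-≤ (length S) (10 * ℓ) t {{>-nonZero 1≤t}} (begin
      length S * t           ≤⟨ ≤-trans (proj₁ (proj₂ S-data)) nK≤5N ⟩
      5 * N                  ≡⟨ cong (5 *_) (m≡m%n+[m/n]*n N ℓ) ⟩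
      5 * (N % ℓ + t * ℓ)    ≤⟨ *-monoʳ-≤ 5 (+-monoˡ-≤ (t * ℓ) (≤-trans (<⇒≤ (m%n<n N ℓ)) (m≤n*m ℓ t {{>-nonZero 1≤t}}))) ⟩
      5 * (t * ℓ + t * ℓ)    ≡⟨ regroup t ℓ ⟩
      10 * ℓ * t             ∎)
      where
      regroup : ∀ t l → 5 * (t * l + t * l) ≡ 10 * l * t
      regroup = solve-∀
    -- In units of `N`: 1 from `t`, `2Δ` from the colour allowance, 30 from `S` with its block,
    -- `10Δ` from the lower levels. With `1 ≤ Δ` this is at most `43Δ`.
    total : ℓ * (threshold + (length S + length S * suc (ℓ ^ Δ))) + Δ * (10 * N) ≤ 43 * (Δ * N)
    total = begin
      ℓ * (threshold + (s + s * suc d)) + Δ * (10 * N)              ≡⟨ expand ℓ t Δ s d N ⟩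
      t * ℓ + 2 * (Δ * ℓ) + ℓ * (s * (2 * 1 + d)) + 10 * (Δ * N)    ≤⟨ +-monoˡ-≤ (10 * (Δ * N)) (+-mono-≤
                                                                        (+-mono-≤ tℓ≤N (*-monoʳ-≤ 2 (*-monoʳ-≤ Δ ℓ≤N))) S-part) ⟩
      N + 2 * (Δ * N) + 30 * N + 10 * (Δ * N)                       ≡⟨ collect N (Δ * N) ⟩
      31 * N + 12 * (Δ * N)                                         ≤⟨ +-monoˡ-≤ (12 * (Δ * N)) (*-monoʳ-≤ 31 (m≤n*m N Δ {{>-nonZero 1≤Δ}})) ⟩
      31 * (Δ * N) + 12 * (Δ * N)                                   ≡⟨ *-distribʳ-+ (Δ * N) 31 12 ⟨
      43 * (Δ * N)                                                  ∎
      where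
      s d : ℕ
      s = length S
      d = ℓ ^ Δ
      1≤d : 1 ≤ d
      1≤d = m^n>0 ℓ Δ
      S-part : ℓ * (s * (2 * 1 + d)) ≤ 30 * N
      S-part = begin
        ℓ * (s * (2 * 1 + d))          ≤⟨ *-monoʳ-≤ ℓ (*-mono-≤ S-size (+-monoˡ-≤ d (*-monoʳ-≤ 2 1≤d))) ⟩
        ℓ * (10 * ℓ * (2 * d + d))     ≡⟨ regroup ℓ d ⟩
        30 * (ℓ * (ℓ * d))             ≤⟨ *-monoʳ-≤ 30 root ⟩
        30 * N                         ∎
        where
        regroup : ∀ l d → l * (10 * l * (2 * d + d)) ≡ 30 * (l * (l * d))
        regroup = solve-∀
      expand : ∀ l t D s d N → l * (t + (D + D) + (s + s * suc d)) + D * (10 * N) ≡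
               t * l + 2 * (D * l) + l * (s * (2 * 1 + d)) + 10 * (D * N)
      expand = solve-∀
      collect : ∀ N M → N + 2 * M + 30 * N + 10 * M ≡ 31 * N + 12 * M
      collect = solve-∀

-- Tiny graphs and the final exponent

n≤1⇒noEdges : ∀ {n} → n ≤ 1 → (G : Graph n) → numEdges G ≡ 0
n≤1⇒noEdges z≤n       G = refl
n≤1⇒noEdges (s≤s z≤n) G rewrite irref G zero = refl

-- As ℓ ≥ 1, the integer root ℓ of n * L satisfies n * L < (2ℓ)^(k+1); this replaces ℓ in the denominator.
clear-root : ∀ k E ℓ n L M .{{_ : NonZero (n * L)}} → n * L < suc ℓ ^ suc k → 1 ≤ ℓ → ℓ * E ≤ M * (n * (n * L)) →
             E ^ suc k ≤ (2 * M) ^ suc k * n ^ (2 * suc k ∸ 1) * L ^ k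
clear-root k E ℓ n L M N< 1≤ℓ ℓE≤ = *-cancelʳ-≤ (E ^ suc k) _ (n * L) (begin
  E ^ suc k * (n * L)              ≤⟨ *-monoʳ-≤ (E ^ suc k) (<⇒≤ N<) ⟩
  E ^ suc k * suc ℓ ^ suc k        ≤⟨ *-monoʳ-≤ (E ^ suc k) (^-monoˡ-≤ (suc k) (+-monoˡ-≤ ℓ 1≤ℓ)) ⟩
  E ^ suc k * (ℓ + ℓ) ^ suc k      ≡⟨ *-^ E (ℓ + ℓ) (suc k) ⟨
  (E * (ℓ + ℓ)) ^ suc k            ≡⟨ cong (_^ suc k) (double E ℓ) ⟩
  (2 * (ℓ * E)) ^ suc k            ≤⟨ ^-monoˡ-≤ (suc k) (*-monoʳ-≤ 2 ℓE≤) ⟩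
  (2 * (M * (n * (n * L)))) ^ suc k ≡⟨ cong (_^ suc k) (regroup M n L) ⟩
  (2 * M * (n * n) * L) ^ suc k    ≡⟨ *-^ (2 * M * (n * n)) L (suc k) ⟩
  (2 * M * (n * n)) ^ suc k * L ^ suc k ≡⟨ cong (_* L ^ suc k) (*-^ (2 * M) (n * n) (suc k)) ⟩
  (2 * M) ^ suc k * (n * n) ^ suc k * L ^ suc k ≡⟨ cong (λ p → (2 * M) ^ suc k * p * L ^ suc k) square ⟩
  (2 * M) ^ suc k * (n ^ (2 * suc k ∸ 1) * n) * (L * L ^ k) ≡⟨ pull ((2 * M) ^ suc k) _ n L (L ^ k) ⟩
  (2 * M) ^ suc k * n ^ (2 * suc k ∸ 1) * L ^ k * (n * L) ∎)
  where
  open ≤-Reasoning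
  double : ∀ E l → E * (l + l) ≡ 2 * (l * E)
  double = solve-∀
  regroup : ∀ M n L → 2 * (M * (n * (n * L))) ≡ 2 * M * (n * n) * L
  regroup = solve-∀
  pull : ∀ A B n L P → A * (B * n) * (L * P) ≡ A * B * P * (n * L)
  pull = solve-∀
  square : (n * n) ^ suc k ≡ n ^ (2 * suc k ∸ 1) * n
  square = begin-equality
    (n * n) ^ suc k              ≡⟨ cong (λ m → (n * m) ^ suc k) (*-identityʳ n) ⟨
    (n ^ 2) ^ suc k              ≡⟨ ^-*-assoc n 2 (suc k) ⟩
    n ^ (2 * suc k)              ≡⟨ *-comm n _ ⟩
    n ^ (2 * suc k ∸ 1) * n      ∎

theorem1p4 : ∃[ C ] (∀ (Δ : ℕ) → 1 ≤ Δ → ∀ (n : ℕ) (G : Graph n) (κ : Coloring n) →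
    ClassesBounded G κ Δ →
    ∃[ H ] (H ⊆G G × CFT+2Spanner G κ H ×
    numEdges H ^ (Δ + 2)
    ≤ C ^ (Δ + 2) * n ^ (2 * (Δ + 2) ∸ 1) * Δ ^ (Δ + 2) * ⌈log₂ n ⌉ ^ (Δ + 1)))
-- 172 is 2 * 86: 86 from `sparse-spanner`, and 2 from rounding the root in `clear-root`.
theorem1p4 = 172 , bound
  where
  bound : ∀ (Δ : ℕ) → 1 ≤ Δ → ∀ (n : ℕ) (G : Graph n) (κ : Coloring n) → ClassesBounded G κ Δ →
          ∃[ H ] (H ⊆G G × CFT+2Spanner G κ H ×
            numEdges H ^ (Δ + 2) ≤ 172 ^ (Δ + 2) * n ^ (2 * (Δ + 2) ∸ 1) * Δ ^ (Δ + 2) * ⌈log₂ n ⌉ ^ (Δ + 1))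
  bound Δ 1≤Δ n G κ bounded with n ≤? 1
  -- Here the logarithm, and with it the bound, is zero, so it matters that there are no edges at
  -- all.
  ... | yes n≤1 rewrite +-comm Δ 2 =
    G , (λ i j e → e) , (λ c u v k p → k , m≤m+n k 2 , p) ,
    subst (λ E → E ^ (2 + Δ) ≤ 172 ^ (2 + Δ) * n ^ (2 * (2 + Δ) ∸ 1) * Δ ^ (2 + Δ) * ⌈log₂ n ⌉ ^ (Δ + 1))
      (≡.sym (n≤1⇒noEdges n≤1 G)) z≤n
  ... | no n≰1 rewrite +-comm Δ 2 | +-comm Δ 1
    with 1≤L ← ⌈log₂⌉-mono-≤ (≰⇒> n≰1)
    -- `ℓ` is the integer part of the `(Δ + 2)`-th root of `n log n`, which balances the cost of the
    -- sources against that of the levels.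
    with ℓ , root , N< ← integerRoot (2 + Δ) (n * ⌈log₂ n ⌉)
    with 1≤N ← *-mono-≤ (<⇒≤ (≰⇒> n≰1)) 1≤L
    with 1≤ℓ ← root>0 (2 + Δ) ℓ 1≤N N<
    with H , H⊆G , spans , size ← sparse-spanner G κ bounded 1≤Δ 1≤L ℓ 1≤ℓ root
    = H , H⊆G , spans , (begin
      numEdges H ^ (2 + Δ)
        ≤⟨ clear-root (suc Δ) (numEdges H) ℓ n L (86 * Δ) {{>-nonZero 1≤N}} N< 1≤ℓ
             (≤-trans size (≤-reflexive (≡.sym (*-assoc 86 Δ _)))) ⟩
      (2 * (86 * Δ)) ^ (2 + Δ) * n ^ (2 * (2 + Δ) ∸ 1) * L ^ suc Δ
        ≡⟨ cong (λ p → p * n ^ (2 * (2 + Δ) ∸ 1) * L ^ suc Δ)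
             (trans (cong (_^ (2 + Δ)) (≡.sym (*-assoc 2 86 Δ))) (*-^ 172 Δ (2 + Δ))) ⟩
      172 ^ (2 + Δ) * Δ ^ (2 + Δ) * n ^ (2 * (2 + Δ) ∸ 1) * L ^ suc Δ
        ≡⟨ cong (_* L ^ suc Δ) (swap (172 ^ (2 + Δ)) (Δ ^ (2 + Δ)) (n ^ (2 * (2 + Δ) ∸ 1))) ⟩
      172 ^ (2 + Δ) * n ^ (2 * (2 + Δ) ∸ 1) * Δ ^ (2 + Δ) * L ^ suc Δ ∎)
    where
    open ≤-Reasoning
    L : ℕ
    L = ⌈log₂ n ⌉
    swap : ∀ A B C → A * B * C ≡ A * C * B
    swap = solve-∀
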